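{- If the basic sequence $Q$ is infinite in limit, then $RN(Q)\setminus\bigcup_{k=1}^\infty N_k(Q)\ne\emptyset$, so $RN(Q)\setminus N(Q)\ne\emptyset$.
   Context: A basic sequence is a sequence $Q=(q_n)_{n\ge1}$ of integers $q_n\ge 2$. The $Q$-Cantor series expansion of $x\in\mathbb{R}$ is the unique expansion $x=E_0+\sum_{n\ge1}\frac{E_n}{q_1\cdots q_n}$ with $E_0=\lfloor x\rfloor$, $E_n\in\{0,\ldots,q_n-1\}$ for $n\ge 1$, and $E_n\ne q_n-1$ infinitely often. $Q$ is infinite in limit if $q_n\to\infty$. Put $Q_n^{(k)}=\sum_{j=1}^n\frac1{q_jq_{j+1}\cdots q_{j+k-1}}$. A block of length $k$ is an ordered $k$-tuple of non-negative integers, and $N_n^Q(B,x)$ is the number of occurrences of $B$ starting at positions $\le n$ in the digits $E_1,E_2,\ldots$ of $x$. $N_k(Q)$ is the set of $x\in\mathbb{R}$ with $\lim_nN_n^Q(B,x)/Q_n^{(k)}=1$ for all blocks $B$ of length $k$, and $N(Q)=\bigcap_{k\ge1}N_k(Q)$. $RN(Q)$ is the set of $x\in\mathbb{R}$ with $\lim_nN_n^Q(B_1,x)/N_n^Q(B_2,x)=1$ for all $k\ge1$ and all blocks $B_1,B_2$ of length $k$. -}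

module Defs where

open import Data.Fin.Base using (toℕ)
open import Data.Integer.Base as ℤ using (ℤ; +_)
open import Data.List.Base using (length; filter; upTo)
open import Data.Nat.Base as ℕ using (ℕ; zero; suc)
open import Data.Nat.Properties as ℕ using (m*n≢0)
open import Data.Product using (Σ-syntax; ∃-syntax; _×_; _,_)
open import Data.Rational.Base as ℚ using (ℚ; 0ℚ; 1ℚ; _/_; _÷_; ∣_∣)
open import Data.Rational.Properties as ℚ using (+-inverseʳ)
open import Data.Vec.Base using (Vec; tabulate)
open import Data.Vec.Properties using (≡-dec)
open import Level using (0ℓ)
open import Relation.Binary.PropositionalEquality using (_≡_; _≢_; cong; sym; subst)
open import Relation.Nullary using (¬_; Dec)
open import Relation.Unary using (Pred; ⋂)

-- Reals given by representing Cauchy sequences: _≡_ is finer than equality of reals.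
record ℝ : Set where
  field
    seq    : ℕ → ℚ
    cauchy : ∀ ε → 0ℚ ℚ.< ε → ∃[ N ] ∀ m n → N ℕ.≤ m → N ℕ.≤ n → ∣ seq m ℚ.- seq n ∣ ℚ.< ε

open ℝ public

fromℚ : ℚ → ℝ
fromℚ p .seq _ = p
fromℚ p .cauchy ε 0<ε =
  0 , λ _ _ _ _ → subst (ℚ._< ε) (sym (cong ∣_∣ (+-inverseʳ p))) 0<ε

infix 4 _<ᴿ_ _≤ᴿ_

_<ᴿ_ : ℝ → ℝ → Set
x <ᴿ y = ∃[ δ ] (0ℚ ℚ.< δ × ∃[ N ] ∀ n → N ℕ.≤ n → seq x n ℚ.+ δ ℚ.< seq y n)

_≤ᴿ_ : ℝ → ℝ → Set
x ≤ᴿ y = ¬ (y <ᴿ x)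

infix 4 _⟶_

-- The two inequalities together say ∣ s n - x ∣ < ε.
_⟶_ : (ℕ → ℚ) → ℝ → Set
s ⟶ x = ∀ ε → 0ℚ ℚ.< ε →
  ∃[ N ] ∀ n → N ℕ.≤ n → fromℚ (s n ℚ.- ε) <ᴿ x × x <ᴿ fromℚ (s n ℚ.+ ε)

-- lim a n / b n = 1, where the quotient need only be defined for large n.
RatioTendsToOne : (a b : ℕ → ℚ) → Set
RatioTendsToOne a b = ∀ ε → 0ℚ ℚ.< ε →
  ∃[ N ] ∀ n → N ℕ.≤ n →
    Σ[ b≢0 ∈ ℚ.NonZero (b n) ] ∣ (a n ÷ b n) {{b≢0}} ℚ.- 1ℚ ∣ ℚ.< ε

∑ : ℕ → (ℕ → ℚ) → ℚ
∑ zero    f = 0ℚ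
∑ (suc n) f = ∑ n f ℚ.+ f n

-- Sequences are indexed from 0 here: term i is q_{i+1}.
record BasicSequence : Set where
  field
    term   : ℕ → ℕ
    2≤term : ∀ i → 2 ℕ.≤ term i

open BasicSequence public

InfiniteInLimit : BasicSequence → Set
InfiniteInLimit Q = ∀ M → ∃[ N ] ∀ n → N ℕ.≤ n → M ℕ.≤ term Q n

-- q_{i+1} q_{i+2} ⋯ q_{i+k}
prod : BasicSequence → (i k : ℕ) → ℕ
prod Q i zero    = 1
prod Q i (suc k) = prod Q i k ℕ.* term Q (i ℕ.+ k)

term≢0 : ∀ Q i → ℕ.NonZero (term Q i)
term≢0 Q i = ℕ.>-nonZero (ℕ.<⇒≤ (2≤term Q i))

prod≢0 : ∀ Q i k → ℕ.NonZero (prod Q i k)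
prod≢0 Q i zero    = _
prod≢0 Q i (suc k) = m*n≢0 _ _ {{prod≢0 Q i k}} {{term≢0 Q (i ℕ.+ k)}}

partialSum : BasicSequence → ℤ → (ℕ → ℕ) → ℕ → ℚ
partialSum Q E₀ E n = E₀ / 1 ℚ.+ ∑ n (λ i → ((+ E i) / prod Q 0 (suc i)) {{prod≢0 Q 0 (suc i)}})

-- digit i is E_{i+1}.
record Expansion (Q : BasicSequence) (x : ℝ) : Set where
  field
    whole       : ℤ
    digit       : ℕ → ℕ
    whole≤x     : fromℚ (whole / 1) ≤ᴿ x
    x<whole+1   : x <ᴿ fromℚ ((whole ℤ.+ ℤ.1ℤ) / 1)
    digit<term  : ∀ i → digit i ℕ.< term Q i
    not-maximal : ∀ N → ∃[ i ] (N ℕ.≤ i × digit i ≢ term Q i ℕ.∸ 1)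
    converges   : partialSum Q whole digit ⟶ x

open Expansion public

Block : ℕ → Set
Block k = Vec ℕ k

OccursAt : ∀ {k} → (ℕ → ℕ) → Block k → Pred ℕ 0ℓ
OccursAt E B i = tabulate (λ t → E (i ℕ.+ toℕ t)) ≡ B

occursAt? : ∀ {k} (E : ℕ → ℕ) (B : Block k) i → Dec (OccursAt E B i)
occursAt? E B i = ≡-dec ℕ._≟_ (tabulate (λ t → E (i ℕ.+ toℕ t))) B

-- N_n^Q(B, x), for x with digits E; the 0-based positions i < n are 1, …, n.
occurrences : ∀ {k} → (ℕ → ℕ) → Block k → ℕ → ℕ
occurrences E B n = length (filter (occursAt? E B) (upTo n))

occurrencesℚ : ∀ {k} → (ℕ → ℕ) → Block k → ℕ → ℚ
occurrencesℚ E B n = (+ occurrences E B n) / 1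

-- Q_n^{(k)}
expected : BasicSequence → (k n : ℕ) → ℚ
expected Q k n = ∑ n (λ j → ((+ 1) / prod Q j k) {{prod≢0 Q j k}})

-- N_k(Q). The expansion is unique, but cannot be computed from x constructively,
-- so membership asks for it as a witness.
NormalOfOrder : BasicSequence → ℕ → Pred ℝ 0ℓ
NormalOfOrder Q k x = Σ[ e ∈ Expansion Q x ]
  ∀ (B : Block k) → RatioTendsToOne (occurrencesℚ (digit e) B) (expected Q k)

-- N(Q)
Normal : BasicSequence → Pred ℝ 0ℓ
Normal Q = ⋂[ j ∶ ℕ ] NormalOfOrder Q (suc j)

-- RN(Q)
RatioNormal : BasicSequence → Pred ℝ 0ℓ
RatioNormal Q x = Σ[ e ∈ Expansion Q x ]
  ∀ j (B₁ B₂ : Block (suc j)) →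
    RatioTendsToOne (occurrencesℚ (digit e) B₁) (occurrencesℚ (digit e) B₂)

{-# OPTIONS --safe #-}
module Submission where

-- The digits of x are built from chunks: chunk t lists all words of length t over {0, …, t − 1},
-- separated by fillers q − 2.  Fillers tend to infinity, so only finitely many occurrences of a
-- given block meet one, and by symmetry any two blocks of equal length occur equally often in
-- chunk t once t exceeds their digits.  Chunks 0, …, 0, 1, …, 1, 2, … are written one after the
-- other, moving on to t only when chunk t is short compared with the number of chunks already
-- written and the terms of Q are from there on at least 4 (∣ chunk t ∣ + 1).  The first condition
-- gives ratio normality.  By the second, Q_n^{(k)} eventually grows by at most 1/4 per chunk
-- whereas every block count grows by at least 1 per chunk, so their ratio cannot tend to 1.

open import Defs
open import Data.Empty using (⊥)
open import Data.Fin.Base using (toℕ)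
open import Data.Integer.Base as ℤ using (ℤ)
import Data.Integer.Properties as ℤ
import Data.Integer.Solver as ℤ-Solver
open import Data.List.Base using (List; []; _∷_; [_]; _++_; map; concatMap; length; filter; upTo; cartesianProductWith; downFrom)
open import Data.List.Properties using (map-++; map-∘; ++-assoc; length-++; filter-++; filter-accept; filter-reject; upTo-∷ʳ)
open import Data.List.Relation.Unary.All as List using ([]; _∷_)
import Data.List.Relation.Unary.All.Properties as List
open import Data.Maybe.Base using (Maybe; just; nothing)
import Data.Maybe.Relation.Unary.All as Maybe
open import Data.Nat.Base hiding (_/_)
open import Data.Nat.ListAction using (sum)
open import Data.Nat.ListAction.Properties using (sum-++)
open import Data.Nat.Properties
open import Data.Nat.Solver using (module +-*-Solver)
open import Data.Product using (Σ-syntax; ∃-syntax; _×_; _,_; proj₁; proj₂)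
open import Data.Rational.Base as ℚ using (ℚ; 0ℚ; 1ℚ; ½; _/_; _÷_) renaming (∣_∣ to abs)
import Data.Rational.Properties as ℚ
import Data.Rational.Solver as ℚ-Solver
open import Data.Rational.Unnormalised.Base as ℚᵘ using (mkℚᵘ; *≡*)
import Data.Rational.Unnormalised.Properties as ℚᵘ
open import Data.Sum.Base using (_⊎_; inj₁; inj₂)
open import Data.Vec.Base using (Vec; []; _∷_; tabulate; replicate)
open import Data.Vec.Properties using (tabulate-cong; ∷-injective)
open import Data.Vec.Relation.Unary.All as Vec using ([]; _∷_)
open import Function.Base using (flip; _∘_)
open import Relation.Binary.Definitions using (Reflexive; Transitive)
open import Relation.Binary.PropositionalEquality using (_≡_; _≢_; refl; sym; trans; cong; cong₂; subst; subst₂; module ≡-Reasoning)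
open import Relation.Nullary using (¬_; Dec; yes; no; contradiction)
open import Relation.Unary using (_∖_; ⋃; Satisfiable)

-- All estimates are made in the number `j` of chunks written so far, not in the position `n`.
-- However fast or slowly the terms of Q tend to infinity, `j` is a lower bound for the position
-- and, up to an additive constant, for every block count. The factor 4 leaves enough room to refute
-- normality with the single tolerance 1: a quotient below 2 would bound a block count by 2 (j/4 +
-- const) = j/2 + const, while the count is at least j - const. The fillers are q - 2 rather than q
-- - 1, so that their infinite number shows that the digits are not eventually maximal. A proof of
-- `NormalOfOrder` carries an expansion of its own, about which nothing is known beforehand.
-- Non-membership therefore also rests on uniqueness of the digits, obtained below from nested
-- intervals.

private variable
  A : Set
  k : ℕ

-- Monotone sequences and sums over lists.

chain : ∀ {A : Set} {_∼_ : A → A → Set} → Reflexive _∼_ → Transitive _∼_ →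
  ∀ (f : ℕ → A) → (∀ n → f n ∼ f (suc n)) → ∀ {m n} → m ≤ n → f m ∼ f n
chain {_∼_ = _∼_} rfl tr f step m≤n = go (≤⇒≤′ m≤n)
  where
  go : ∀ {m n} → m ≤′ n → f m ∼ f n
  go ≤′-refl       = rfl
  go (≤′-step m≤n) = tr (go m≤n) (step _)

≤-chain : ∀ (f : ℕ → ℕ) → (∀ n → f n ≤ f (suc n)) → ∀ {m n} → m ≤ n → f m ≤ f n
≤-chain = chain {_∼_ = _≤_} ≤-refl ≤-trans

∣-∣-bound : ∀ {a b c} → a ≤ c + b → b ≤ c + a → ∣ a - b ∣ ≤ c
∣-∣-bound {a} {b} {c} a≤ b≤ with ∣m-n∣≡[m∸n]∨[n∸m] a b
... | inj₁ eq = subst (_≤ c) (sym eq) (m≤n+o⇒m∸n≤o a b (subst (a ≤_) (+-comm c b) a≤))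
... | inj₂ eq = subst (_≤ c) (sym eq) (m≤n+o⇒m∸n≤o b a (subst (b ≤_) (+-comm c a) b≤))

total : (A → ℕ) → List A → ℕ
total f xs = sum (map f xs)

total-++ : ∀ (f : A → ℕ) xs ys → total f (xs ++ ys) ≡ total f xs + total f ys
total-++ f xs ys = trans (cong sum (map-++ f xs ys)) (sum-++ (map f xs) (map f ys))

total-map : ∀ {B : Set} (f : B → ℕ) (g : A → B) xs → total f (map g xs) ≡ total (f ∘ g) xs
total-map f g xs = cong sum (sym (map-∘ xs))

total-+ : ∀ (f g : A → ℕ) xs → total (λ x → f x + g x) xs ≡ total f xs + total g xs
total-+ f g []       = refl
total-+ f g (x ∷ xs) rewrite total-+ f g xs =
  solve 4 (λ a b c d → (a :+ b) :+ (c :+ d) := (a :+ c) :+ (b :+ d)) refl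
    (f x) (g x) (total f xs) (total g xs)
  where open +-*-Solver

total-zero : ∀ (xs : List A) → total (λ _ → 0) xs ≡ 0
total-zero []       = refl
total-zero (x ∷ xs) = total-zero xs

-- Block counts in words and chunks.

when : Dec A → ℕ → ℕ
when (yes _) n = n
when (no  _) _ = 0

-- In a List (Maybe ℕ), nothing stands for a filler, which matches no digit of a block.
startsWith : Vec ℕ k → List (Maybe ℕ) → ℕ
startsWith []      _             = 1
startsWith (b ∷ B) []            = 0
startsWith (b ∷ B) (nothing ∷ _) = 0
startsWith (b ∷ B) (just d ∷ xs) = when (b ≟ d) (startsWith B xs)

countIn : Vec ℕ k → List (Maybe ℕ) → ℕ
countIn B []       = 0
countIn B (x ∷ xs) = startsWith B (x ∷ xs) + countIn B xs

startsWith≤1 : ∀ (B : Vec ℕ k) xs → startsWith B xs ≤ 1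
startsWith≤1 []      _             = ≤-refl
startsWith≤1 (b ∷ B) []            = z≤n
startsWith≤1 (b ∷ B) (nothing ∷ _) = z≤n
startsWith≤1 (b ∷ B) (just d ∷ xs) with b ≟ d
... | yes _ = startsWith≤1 B xs
... | no  _ = z≤n

countIn≤length : ∀ (B : Vec ℕ k) xs → countIn B xs ≤ length xs
countIn≤length B []       = z≤n
countIn≤length B (x ∷ xs) = +-mono-≤ (startsWith≤1 B (x ∷ xs)) (countIn≤length B xs)

startsWith-separated : ∀ (B : Vec ℕ k) w ys →
  startsWith B (map just w ++ nothing ∷ ys) ≡ startsWith B (map just w)
startsWith-separated []      w       ys = refl
startsWith-separated (b ∷ B) []      ys = refl
startsWith-separated (b ∷ B) (d ∷ w) ys with b ≟ d
... | yes _ = startsWith-separated B w ys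
... | no  _ = refl

-- No occurrence can cross or start at a filler. The block has to be nonempty, because the empty
-- block would also be counted at the filler itself.
countIn-separated : ∀ (B : Vec ℕ (suc k)) w ys →
  countIn B (map just w ++ nothing ∷ ys) ≡ countIn B (map just w) + countIn B ys
countIn-separated (b ∷ B) []      ys = refl
countIn-separated B       (d ∷ w) ys
  rewrite countIn-separated B w ys | startsWith-separated B (d ∷ w) ys =
  sym (+-assoc (startsWith B (map just (d ∷ w))) _ _)

-- With `downFrom` the largest digit comes first, so enlarging the alphabet by one digit prepends
-- one slice `map (n ∷_) ws`. The inductions on `n` below peel off this slice.
words : (n L : ℕ) → List (List ℕ)
words n zero    = [ [] ]
words n (suc L) = cartesianProductWith _∷_ (downFrom n) (words n L)

chunk : ℕ → List (Maybe ℕ)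
chunk n = concatMap (λ w → map just w ++ [ nothing ]) (words n n)

totalStarts : Vec ℕ k → List (List ℕ) → ℕ
totalStarts B = total (startsWith B ∘ map just)

totalCount : Vec ℕ k → List (List ℕ) → ℕ
totalCount B = total (countIn B ∘ map just)

countIn-concatMap : ∀ (B : Vec ℕ (suc k)) ws →
  countIn B (concatMap (λ w → map just w ++ [ nothing ]) ws) ≡ totalCount B ws
countIn-concatMap B []       = refl
countIn-concatMap B (w ∷ ws) = begin
  countIn B ((map just w ++ [ nothing ]) ++ rest)  ≡⟨ cong (countIn B) (++-assoc (map just w) _ _) ⟩
  countIn B (map just w ++ nothing ∷ rest)         ≡⟨ countIn-separated B w rest ⟩
  countIn B (map just w) + countIn B rest          ≡⟨ cong (countIn B (map just w) +_) (countIn-concatMap B ws) ⟩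
  totalCount B (w ∷ ws)                            ∎
  where
  open ≡-Reasoning
  rest = concatMap (λ w → map just w ++ [ nothing ]) ws

totalStarts-digit : ∀ b (B : Vec ℕ k) d ws →
  totalStarts (b ∷ B) (map (d ∷_) ws) ≡ (when (b ≟ d) (totalStarts B ws))
totalStarts-digit b B d ws = trans (total-map _ (d ∷_) ws) splitDigit
  where
  splitDigit : total (λ w → when (b ≟ d) (startsWith B (map just w))) ws
             ≡ (when (b ≟ d) (totalStarts B ws))
  splitDigit with b ≟ d
  ... | yes _ = refl
  ... | no  _ = total-zero ws

totalStarts-large : ∀ {n b} (B : Vec ℕ k) ws → n ≤ b →
  totalStarts (b ∷ B) (cartesianProductWith _∷_ (downFrom n) ws) ≡ 0
totalStarts-large {n = zero}          B ws n≤b = refl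
totalStarts-large {n = suc n} {b = b} B ws n<b = begin
  totalStarts (b ∷ B) (map (n ∷_) ws ++ rest)                    ≡⟨ total-++ _ (map (n ∷_) ws) rest ⟩
  totalStarts (b ∷ B) (map (n ∷_) ws) + totalStarts (b ∷ B) rest ≡⟨ cong₂ _+_ (totalStarts-digit b B n ws) (totalStarts-large B ws (<⇒≤ n<b)) ⟩
  (when (b ≟ n) (totalStarts B ws)) + 0             ≡⟨ other ⟩
  0                                                              ∎
  where
  open ≡-Reasoning
  rest = cartesianProductWith _∷_ (downFrom n) ws
  other : (when (b ≟ n) (totalStarts B ws)) + 0 ≡ 0
  other with b ≟ n
  ... | yes refl = contradiction n<b (<-irrefl refl)
  ... | no  _    = refl

totalStarts-product : ∀ {n b} (B : Vec ℕ k) ws → b < n →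
  totalStarts (b ∷ B) (cartesianProductWith _∷_ (downFrom n) ws) ≡ totalStarts B ws
totalStarts-product {n = suc n} {b = b} B ws b<1+n = begin
  totalStarts (b ∷ B) (map (n ∷_) ws ++ rest)                                ≡⟨ total-++ _ (map (n ∷_) ws) rest ⟩
  totalStarts (b ∷ B) (map (n ∷_) ws) + totalStarts (b ∷ B) rest             ≡⟨ cong (_+ totalStarts (b ∷ B) rest) (totalStarts-digit b B n ws) ⟩
  (when (b ≟ n) (totalStarts B ws)) + totalStarts (b ∷ B) rest  ≡⟨ byDigit ⟩
  totalStarts B ws                                                           ∎
  where
  open ≡-Reasoning
  rest = cartesianProductWith _∷_ (downFrom n) ws
  byDigit : (when (b ≟ n) (totalStarts B ws)) + totalStarts (b ∷ B) rest ≡ totalStarts B ws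
  byDigit with b ≟ n
  ... | yes refl = trans (cong (totalStarts B ws +_) (totalStarts-large {n = n} B ws ≤-refl)) (+-identityʳ _)
  ... | no b≢n   = totalStarts-product B ws (≤∧≢⇒< (≤-pred b<1+n) b≢n)

-- Fixing the first digit leaves all words of length L - 1 over the same alphabet, whichever digit
-- was fixed, so only the length of the block matters.
totalStarts-words : ∀ n L {B₁ B₂ : Vec ℕ k} → Vec.All (_< n) B₁ → Vec.All (_< n) B₂ →
  totalStarts B₁ (words n L) ≡ totalStarts B₂ (words n L)
totalStarts-words n L       []         []         = refl
totalStarts-words n zero    (_ ∷ _)    (_ ∷ _)    = refl
totalStarts-words n (suc L) (p₁ ∷ ps₁) (p₂ ∷ ps₂) =
  trans (totalStarts-product _ (words n L) p₁)
    (trans (totalStarts-words n L ps₁ ps₂) (sym (totalStarts-product _ (words n L) p₂)))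

-- Some word begins with `B`: once `B` is used up, the word is completed by arbitrary digits, which
-- takes a nonempty alphabet.
totalStarts>0 : ∀ n L {B : Vec ℕ k} → k ≤ L → 0 < n → Vec.All (_< n) B →
  0 < totalStarts B (words n L)
totalStarts>0 n       zero    z≤n       0<n []       = ≤-refl
totalStarts>0 (suc n) (suc L) z≤n       0<n []       = begin-strict
  0                                                         <⟨ totalStarts>0 (suc n) L z≤n 0<n [] ⟩
  totalStarts [] ws                                         ≡⟨ total-map _ (n ∷_) ws ⟨
  totalStarts [] (map (n ∷_) ws)                            ≤⟨ m≤m+n _ _ ⟩
  totalStarts [] (map (n ∷_) ws) + totalStarts [] rest      ≡⟨ total-++ _ (map (n ∷_) ws) rest ⟨
  totalStarts [] (words (suc n) (suc L))                    ∎
  where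
  open ≤-Reasoning
  ws   = words (suc n) L
  rest = cartesianProductWith _∷_ (downFrom n) ws
totalStarts>0 n       (suc L) (s≤s k≤L) 0<n (p ∷ ps) =
  subst (0 <_) (sym (totalStarts-product _ (words n L) p)) (totalStarts>0 n L k≤L 0<n ps)

-- An occurrence in `d ∷ w` either starts at `d` or lies in `w`, and each `w` appears once for each
-- of the `n` choices of `d`.
totalCount-product : ∀ (B : Vec ℕ k) n ws →
  let product = cartesianProductWith _∷_ (downFrom n) ws in
  totalCount B product ≡ totalStarts B product + n * totalCount B ws
totalCount-product B zero    ws = refl
totalCount-product B (suc n) ws = begin
  totalCount B (map (n ∷_) ws ++ rest)
    ≡⟨ total-++ _ (map (n ∷_) ws) rest ⟩
  totalCount B (map (n ∷_) ws) + totalCount B rest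
    ≡⟨ cong₂ _+_ byOffset (totalCount-product B n ws) ⟩
  (totalStarts B (map (n ∷_) ws) + totalCount B ws) + (totalStarts B rest + n * totalCount B ws)
    ≡⟨ solve 4 (λ a b c d → (a :+ b) :+ (c :+ d) := (a :+ c) :+ (b :+ d)) refl
         (totalStarts B (map (n ∷_) ws)) (totalCount B ws) (totalStarts B rest) (n * totalCount B ws) ⟩
  (totalStarts B (map (n ∷_) ws) + totalStarts B rest) + suc n * totalCount B ws
    ≡⟨ cong (_+ suc n * totalCount B ws) (total-++ _ (map (n ∷_) ws) rest) ⟨
  totalStarts B (map (n ∷_) ws ++ rest) + suc n * totalCount B ws ∎
  where
  open ≡-Reasoning
  open +-*-Solver
  rest = cartesianProductWith _∷_ (downFrom n) ws
  byOffset : totalCount B (map (n ∷_) ws) ≡ totalStarts B (map (n ∷_) ws) + totalCount B ws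
  byOffset = begin
    totalCount B (map (n ∷_) ws)
      ≡⟨ total-map _ (n ∷_) ws ⟩
    total (λ w → startsWith B (map just (n ∷ w)) + countIn B (map just w)) ws
      ≡⟨ total-+ (λ w → startsWith B (map just (n ∷ w))) (countIn B ∘ map just) ws ⟩
    total (λ w → startsWith B (map just (n ∷ w))) ws + totalCount B ws
      ≡⟨ cong (_+ totalCount B ws) (total-map _ (n ∷_) ws) ⟨
    totalStarts B (map (n ∷_) ws) + totalCount B ws ∎

totalCount-words : ∀ n L {B₁ B₂ : Vec ℕ k} → Vec.All (_< n) B₁ → Vec.All (_< n) B₂ →
  totalCount B₁ (words n L) ≡ totalCount B₂ (words n L)
totalCount-words n zero    ps₁ ps₂ = refl
totalCount-words n (suc L) {B₁} {B₂} ps₁ ps₂ = begin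
  totalCount B₁ (words n (suc L))                                           ≡⟨ totalCount-product B₁ n _ ⟩
  totalStarts B₁ (words n (suc L)) + n * totalCount B₁ (words n L)          ≡⟨ cong₂ (λ s c → s + n * c) (totalStarts-words n (suc L) ps₁ ps₂) (totalCount-words n L ps₁ ps₂) ⟩
  totalStarts B₂ (words n (suc L)) + n * totalCount B₂ (words n L)          ≡⟨ totalCount-product B₂ n _ ⟨
  totalCount B₂ (words n (suc L))                                           ∎
  where open ≡-Reasoning

countIn-chunk : ∀ {n} {B₁ B₂ : Vec ℕ (suc k)} → Vec.All (_< n) B₁ → Vec.All (_< n) B₂ →
  countIn B₁ (chunk n) ≡ countIn B₂ (chunk n)
countIn-chunk {n = n} ps₁ ps₂ = trans (countIn-concatMap _ (words n n))
  (trans (totalCount-words n n ps₁ ps₂) (sym (countIn-concatMap _ (words n n))))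

countIn-chunk>0 : ∀ {n} {B : Vec ℕ (suc k)} → suc k ≤ n → Vec.All (_< n) B →
  0 < countIn B (chunk n)
countIn-chunk>0 {n = n@(suc m)} {B} k<n ps = begin-strict
  0                                                        <⟨ totalStarts>0 n n k<n z<s ps ⟩
  totalStarts B (words n n)                                ≤⟨ m≤m+n _ _ ⟩
  totalStarts B (words n n) + n * totalCount B (words n m) ≡⟨ totalCount-product B n (words n m) ⟨
  totalCount B (words n n)                                 ≡⟨ countIn-concatMap B (words n n) ⟨
  countIn B (chunk n)                                      ∎
  where open ≤-Reasoning

words-bounded : ∀ n L → List.All (List.All (_< n)) (words n L)
words-bounded n zero    = [] ∷ []
words-bounded n (suc L) = product n ≤-refl
  where
  product : ∀ m → m ≤ n → List.All (List.All (_< n)) (cartesianProductWith _∷_ (downFrom m) (words n L))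
  product zero    _   = []
  product (suc m) m<n =
    List.++⁺ (List.map⁺ (List.map (m<n ∷_) (words-bounded n L))) (product m (<⇒≤ m<n))

chunk-bounded : ∀ n → List.All (Maybe.All (_< n)) (chunk n)
chunk-bounded n = List.concat⁺ (List.map⁺ (List.map separated (words-bounded n n)))
  where
  separated : ∀ {w} → List.All (_< n) w → List.All (Maybe.All (_< n)) (map just w ++ [ nothing ])
  separated ps = List.++⁺ (List.map⁺ (List.map Maybe.just ps)) (Maybe.nothing ∷ [])

bounded : ∀ (B : Vec ℕ k) → ∃[ m ] Vec.All (_< m) B
bounded []      = 0 , []
bounded (b ∷ B) with m , B<m ← bounded B =
  suc b ⊔ m , m≤m⊔n (suc b) m ∷ Vec.map (λ d<m → <-≤-trans d<m (m≤n⊔m (suc b) m)) B<m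

-- Occurrences of a block in a digit sequence.

occursAt-∷ : ∀ (E : ℕ → ℕ) i {b} {B : Vec ℕ k} →
  E i ≡ b → OccursAt E B (suc i) → OccursAt E (b ∷ B) i
occursAt-∷ E i Ei≡b B-occurs = cong₂ _∷_ (trans (cong E (+-identityʳ i)) Ei≡b)
  (trans (tabulate-cong λ t → cong E (+-suc i (toℕ t))) B-occurs)

occursAt-∷⁻ : ∀ (E : ℕ → ℕ) i {b} {B : Vec ℕ k} →
  OccursAt E (b ∷ B) i → E i ≡ b × OccursAt E B (suc i)
occursAt-∷⁻ E i occurs with Ei≡b , B-occurs ← ∷-injective occurs =
  trans (cong E (sym (+-identityʳ i))) Ei≡b ,
  trans (tabulate-cong λ t → cong E (sym (+-suc i (toℕ t)))) B-occurs

occurrences-suc : ∀ (E : ℕ → ℕ) (B : Vec ℕ k) n →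
  occurrences E B (suc n) ≡ occurrences E B n + length (filter (occursAt? E B) [ n ])
occurrences-suc E B n = begin
  length (filter (occursAt? E B) (upTo (suc n)))       ≡⟨ cong (λ is → length (filter (occursAt? E B) is)) (upTo-∷ʳ n) ⟨
  length (filter (occursAt? E B) (upTo n ++ [ n ]))    ≡⟨ cong length (filter-++ (occursAt? E B) (upTo n) [ n ]) ⟩
  length (filter (occursAt? E B) (upTo n) ++ filter (occursAt? E B) [ n ]) ≡⟨ length-++ (filter (occursAt? E B) (upTo n)) ⟩
  occurrences E B n + length (filter (occursAt? E B) [ n ]) ∎
  where open ≡-Reasoning

occurrences-hit : ∀ (E : ℕ → ℕ) (B : Vec ℕ k) {n} → OccursAt E B n →
  occurrences E B (suc n) ≡ occurrences E B n + 1
occurrences-hit E B {n} hit = trans (occurrences-suc E B n)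
  (cong (λ is → occurrences E B n + length is) (filter-accept (occursAt? E B) hit))

occurrences-miss : ∀ (E : ℕ → ℕ) (B : Vec ℕ k) {n} → ¬ OccursAt E B n →
  occurrences E B (suc n) ≡ occurrences E B n
occurrences-miss E B {n} miss = trans (occurrences-suc E B n)
  (trans (cong (λ is → occurrences E B n + length is) (filter-reject (occursAt? E B) miss)) (+-identityʳ _))

occurrences-mono : ∀ (E : ℕ → ℕ) (B : Vec ℕ k) {m n} → m ≤ n → occurrences E B m ≤ occurrences E B n
occurrences-mono E B = ≤-chain (occurrences E B) λ n →
  ≤-trans (m≤m+n _ _) (≤-reflexive (sym (occurrences-suc E B n)))

occurrences≤ : ∀ (E : ℕ → ℕ) (B : Vec ℕ k) n → occurrences E B n ≤ n
occurrences≤ E B zero = z≤n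
occurrences≤ E B (suc n) with occursAt? E B n
... | yes hit = ≤-trans (≤-reflexive (occurrences-hit E B hit))
                  (≤-trans (+-monoˡ-≤ 1 (occurrences≤ E B n)) (≤-reflexive (+-comm n 1)))
... | no miss = ≤-trans (≤-reflexive (occurrences-miss E B miss)) (m≤n⇒m≤1+n (occurrences≤ E B n))

-- The digit sequence and its block counts.

module Construction (Q : BasicSequence) (Q→∞ : InfiniteInLimit Q) where

  -- Counts the filler written while the chunk is being loaded.
  size : ℕ → ℕ
  size s = suc (length (chunk s))

  -- The summand s makes the digits of chunk s admissible, the summand 4 * size s keeps
  -- the increase of the expected count over one chunk below 1/4.
  demand : ℕ → ℕ
  demand s = s + 4 * size s

  -- The first argument of the maximum is a position, yet it is compared with the chunk index. This
  -- is safe because chunk `j` never starts before position `j` (`j≤chunkStart`).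
  threshold : ℕ → ℕ
  threshold s = proj₁ (Q→∞ (demand s)) ⊔ s * size s

  stage : ℕ → ℕ
  stage zero    = 0
  stage (suc j) with threshold (suc (stage j)) ≤? suc j
  ... | yes _ = suc (stage j)
  ... | no  _ = stage j

  -- The threshold of stage 0 is never tested, hence the first alternative. A threshold that was
  -- reached once stays reached.
  threshold-stage : ∀ j → stage j ≡ 0 ⊎ threshold (stage j) ≤ j
  threshold-stage zero    = inj₁ refl
  threshold-stage (suc j) with threshold (suc (stage j)) ≤? suc j
  ... | yes reached = inj₂ reached
  ... | no  _       with threshold-stage j
  ...   | inj₁ ≡0 = inj₁ ≡0
  ...   | inj₂ ≤j = inj₂ (m≤n⇒m≤1+n ≤j)

  -- Once the stage is at least `s` and the index has passed `threshold (suc s)`, a stage equal to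
  -- `s` passes the test at the very next index.
  stage-unbounded : ∀ s → ∃[ J ] ∀ {j} → J ≤ j → s ≤ stage j
  stage-unbounded zero    = 0 , λ _ → z≤n
  stage-unbounded (suc s) with J , s≤stage ← stage-unbounded s =
    suc (J ⊔ threshold (suc s)) , above
    where
    above : ∀ {j} → J ⊔ threshold (suc s) < j → s < stage j
    above {suc j} (s≤s J′≤j) with threshold (suc (stage j)) ≤? suc j
    ... | yes _       = s≤s (s≤stage (m⊔n≤o⇒m≤o J _ J′≤j))
    ... | no  waiting with m≤n⇒m<n∨m≡n (s≤stage {j} (m⊔n≤o⇒m≤o J _ J′≤j))
    ...   | inj₁ s<stage = s<stage
    ...   | inj₂ refl    = contradiction (m≤n⇒m≤1+n (m⊔n≤o⇒n≤o J _ J′≤j)) waiting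

  demand≤term : ∀ {j i} → 0 < stage j → j ≤ i → demand (stage j) ≤ term Q i
  demand≤term {j} {i} 0<s j≤i with threshold-stage j
  ... | inj₁ s≡0 = contradiction s≡0 (>⇒≢ 0<s)
  ... | inj₂ t≤j = proj₂ (Q→∞ (demand (stage j))) i (≤-trans (m⊔n≤o⇒m≤o _ _ t≤j) j≤i)

  stage*size≤ : ∀ j → stage j * size (stage j) ≤ j
  stage*size≤ j with threshold-stage j
  ... | inj₁ s≡0 rewrite s≡0 = z≤n
  ... | inj₂ t≤j = m⊔n≤o⇒n≤o (proj₁ (Q→∞ (demand (stage j)))) _ t≤j

  stage≤term : ∀ {j i} → j ≤ i → stage j ≤ term Q i
  stage≤term {j} j≤i with stage j in eq
  ... | zero  = z≤n
  ... | suc s = subst (_≤ _) eq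
    (≤-trans (m≤m+n (stage j) _) (demand≤term {j} (subst (0 <_) (sym eq) z<s) j≤i))

  -- The digits still to be written, and the number of chunks loaded so far.
  State : Set
  State = List (Maybe ℕ) × ℕ

  -- Loading takes a position of its own, at which `emit` writes a filler, so each step of the
  -- iteration produces exactly one digit.
  next : State → State
  next ([]     , j) = chunk (stage j) , suc j
  next (_ ∷ xs , j) = xs , j

  state : ℕ → State
  state zero    = [] , 0
  state (suc i) = next (state i)

  pending : ℕ → List (Maybe ℕ)
  pending i = proj₁ (state i)

  filler : ℕ → ℕ
  filler i = term Q i ∸ 2

  emit : ℕ → List (Maybe ℕ) → ℕ
  emit i []            = filler i
  emit i (nothing ∷ _) = filler i
  emit i (just d ∷ _)  = d

  E : ℕ → ℕ
  E i = emit i (pending i)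

  pending-tail : ∀ i {x xs} → pending i ≡ x ∷ xs → pending (suc i) ≡ xs
  pending-tail i eq with state i
  pending-tail i refl | _ ∷ _ , _ = refl

  loaded≤ : ∀ i → proj₂ (state i) ≤ i
  loaded≤ zero    = z≤n
  loaded≤ (suc i) with state i | loaded≤ i
  ... | []     , j | j≤i = s≤s j≤i
  ... | _ ∷ xs , j | j≤i = m≤n⇒m≤1+n j≤i

  -- A pending digit is written only later, so the invariant has to bound it by the terms at all
  -- positions from `i` on.
  pending-bounded : ∀ i → List.All (Maybe.All (λ d → ∀ h → i ≤ h → d < term Q h)) (pending i)
  pending-bounded zero    = []
  pending-bounded (suc i) with state i | loaded≤ i | pending-bounded i
  ... | []     , j | j≤i | _      = List.map (Maybe.map λ d<s _ i<h → <-≤-trans d<s (stage≤term (≤-trans j≤i (<⇒≤ i<h)))) (chunk-bounded (stage j))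
  ... | _ ∷ xs , j | _   | _ ∷ ps = List.map (Maybe.map λ d<q h i<h → d<q h (<⇒≤ i<h)) ps

  filler<term : ∀ i → filler i < term Q i
  filler<term i = ∸-monoʳ-< {o = 0} z<s (2≤term Q i)

  E<term : ∀ i → E i < term Q i
  E<term i with pending i | pending-bounded i
  ... | []          | _                = filler<term i
  ... | nothing ∷ _ | _                = filler<term i
  ... | just d ∷ _  | Maybe.just p ∷ _ = p i ≤-refl

  state-run : ∀ xs {i j} → state i ≡ (xs , j) → state (length xs + i) ≡ ([] , j)
  state-run []       eq = eq
  state-run (x ∷ xs) {i} {j} eq =
    subst (λ h → state h ≡ ([] , j)) (+-suc (length xs) i) (state-run xs (cong next eq))

  E-not-maximal : ∀ N → ∃[ i ] (N ≤ i × E i ≢ term Q i ∸ 1)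
  E-not-maximal N = i , m≤n+m N _ , λ Ei≡ →
    <⇒≢ (∸-monoʳ-< {o = 1} (s≤s z<s) (2≤term Q i)) (trans (sym Ei≡filler) Ei≡)
    where
    -- Here the list pending at `N` has been written out, and the filler of the next loading is due.
    i = length (pending N) + N
    Ei≡filler : E i ≡ filler i
    Ei≡filler = cong (λ s → emit i (proj₁ s)) (state-run (pending N) {N} refl)

  -- Occurrences before n that avoid all fillers.
  starts : Vec ℕ k → ℕ → ℕ
  starts B zero    = 0
  starts B (suc n) = starts B n + startsWith B (pending n)

  starts-mono : ∀ (B : Vec ℕ k) {m n} → m ≤ n → starts B m ≤ starts B n
  starts-mono B = ≤-chain (starts B) λ n → m≤m+n _ _

  starts-run : ∀ (B : Vec ℕ k) xs {i j} → state i ≡ (xs , j) →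
    starts B (length xs + i) ≡ starts B i + countIn B xs
  starts-run B []       eq = sym (+-identityʳ _)
  starts-run B (x ∷ xs) {i} eq = begin
    starts B (suc (length xs + i))                          ≡⟨ cong (starts B) (+-suc (length xs) i) ⟨
    starts B (length xs + suc i)                            ≡⟨ starts-run B xs (cong next eq) ⟩
    starts B i + startsWith B (pending i) + countIn B xs    ≡⟨ cong (λ s → starts B i + startsWith B (proj₁ s) + countIn B xs) eq ⟩
    starts B i + startsWith B (x ∷ xs) + countIn B xs       ≡⟨ +-assoc (starts B i) _ _ ⟩
    starts B i + countIn B (x ∷ xs)                         ∎
    where open ≡-Reasoning

  -- The position of the loading filler of chunk `j`; the chunk proper begins one position later,
  -- where `state-run` and `starts-run` are applied.
  chunkStart : ℕ → ℕ
  chunkStart zero    = 0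
  chunkStart (suc j) = length (chunk (stage j)) + suc (chunkStart j)

  chunkStart-suc : ∀ j → chunkStart (suc j) ≡ size (stage j) + chunkStart j
  chunkStart-suc j = +-suc (length (chunk (stage j))) (chunkStart j)

  state-chunkStart : ∀ j → state (chunkStart j) ≡ ([] , j)
  state-chunkStart zero    = refl
  state-chunkStart (suc j) = state-run (chunk (stage j)) (cong next (state-chunkStart j))

  starts-chunkStart : ∀ (B : Vec ℕ (suc k)) j →
    starts B (chunkStart (suc j)) ≡ starts B (chunkStart j) + countIn B (chunk (stage j))
  starts-chunkStart B@(_ ∷ _) j = begin
    starts B (chunkStart (suc j))                                    ≡⟨ starts-run B (chunk (stage j)) (cong next (state-chunkStart j)) ⟩
    starts B (chunkStart j) + startsWith B (pending (chunkStart j)) + count ≡⟨ cong (λ s → starts B (chunkStart j) + startsWith B (proj₁ s) + count) (state-chunkStart j) ⟩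
    starts B (chunkStart j) + 0 + count                              ≡⟨ cong (_+ count) (+-identityʳ _) ⟩
    starts B (chunkStart j) + count                                  ∎
    where
    open ≡-Reasoning
    count = countIn B (chunk (stage j))

  chunkStart<chunkStart-suc : ∀ j → chunkStart j < chunkStart (suc j)
  chunkStart<chunkStart-suc j = ≤-trans (s≤s (m≤n+m (chunkStart j) _)) (≤-reflexive (sym (chunkStart-suc j)))

  chunkStart-mono : ∀ {i j} → i ≤ j → chunkStart i ≤ chunkStart j
  chunkStart-mono = ≤-chain chunkStart λ j → <⇒≤ (chunkStart<chunkStart-suc j)

  j≤chunkStart : ∀ j → j ≤ chunkStart j
  j≤chunkStart zero    = z≤n
  j≤chunkStart (suc j) = ≤-trans (s≤s (j≤chunkStart j)) (chunkStart<chunkStart-suc j)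

  locate : ∀ n → ∃[ j ] (chunkStart j ≤ n × n < chunkStart (suc j))
  locate zero    = 0 , z≤n , ≤-<-trans z≤n (chunkStart<chunkStart-suc 0)
  locate (suc n) with locate n
  ... | j , j≤n , n<j+1 with m≤n⇒m<n∨m≡n n<j+1
  ...   | inj₁ <j+1 = j , m≤n⇒m≤1+n j≤n , <j+1
  ...   | inj₂ ≡j+1 = suc j , ≤-reflexive (sym ≡j+1) , subst (_< chunkStart (suc (suc j))) (sym ≡j+1) (chunkStart<chunkStart-suc (suc j))

  countIn-settles : ∀ (B : Vec ℕ (suc k)) → ∃[ J ] ∀ {j} → J ≤ j → 0 < countIn B (chunk (stage j))
  countIn-settles {k} B with m , B<m ← bounded B with J , ≤stage ← stage-unbounded (suc k ⊔ m) =
    J , λ J≤j → countIn-chunk>0 (m⊔n≤o⇒m≤o (suc k) m (≤stage J≤j)) (Vec.map (λ d<m → <-≤-trans d<m (m⊔n≤o⇒n≤o (suc k) _ (≤stage J≤j))) B<m)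

  countIn-agree : ∀ (B₁ B₂ : Vec ℕ (suc k)) →
    ∃[ J ] ∀ {j} → J ≤ j → countIn B₁ (chunk (stage j)) ≡ countIn B₂ (chunk (stage j))
  countIn-agree B₁ B₂ with m₁ , B₁<m ← bounded B₁ | m₂ , B₂<m ← bounded B₂
    with J , ≤stage ← stage-unbounded (m₁ ⊔ m₂) =
    J , λ J≤j → countIn-chunk (Vec.map (λ d<m → <-≤-trans d<m (m⊔n≤o⇒m≤o _ _ (≤stage J≤j))) B₁<m)
                              (Vec.map (λ d<m → <-≤-trans d<m (m⊔n≤o⇒n≤o m₁ _ (≤stage J≤j))) B₂<m)

  -- Every chunk from `J` on contains `B` at least once; the summand `J` makes up for the chunks
  -- before.
  starts-linear : ∀ (B : Vec ℕ (suc k)) → ∃[ J ] ∀ j → j ≤ J + starts B (chunkStart j)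
  starts-linear B with J , settled ← countIn-settles B = J , linear
    where
    linear : ∀ j → j ≤ J + starts B (chunkStart j)
    linear zero    = z≤n
    linear (suc j) with ≤-<-connex (suc j) J
    ... | inj₁ j<J = ≤-trans j<J (m≤m+n J _)
    ... | inj₂ J<j = begin
      suc j                                                         ≤⟨ s≤s (linear j) ⟩
      suc (J + starts B (chunkStart j))                                  ≡⟨ +-comm 1 _ ⟩
      J + starts B (chunkStart j) + 1                                    ≤⟨ +-monoʳ-≤ _ (settled (≤-pred J<j)) ⟩
      J + starts B (chunkStart j) + countIn B (chunk (stage j))          ≡⟨ +-assoc J _ _ ⟩
      J + (starts B (chunkStart j) + countIn B (chunk (stage j)))        ≡⟨ cong (J +_) (starts-chunkStart B j) ⟨
      J + starts B (chunkStart (suc j))                                  ∎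
      where open ≤-Reasoning

  -- From chunk `J` on both counts gain the same amount per chunk, so the lead of `B₁` never exceeds
  -- what it had collected up to there.
  starts-close : ∀ (B₁ B₂ : Vec ℕ (suc k)) →
    ∃[ D ] ∀ j → starts B₁ (chunkStart j) ≤ D + starts B₂ (chunkStart j)
  starts-close B₁ B₂ with J , agree ← countIn-agree B₁ B₂ = starts B₁ (chunkStart J) , close
    where
    D = starts B₁ (chunkStart J)
    close : ∀ j → starts B₁ (chunkStart j) ≤ D + starts B₂ (chunkStart j)
    close zero    = z≤n
    close (suc j) with ≤-<-connex (suc j) J
    ... | inj₁ j<J = ≤-trans (starts-mono B₁ (chunkStart-mono j<J)) (m≤m+n D _)
    ... | inj₂ J<j = begin
      starts B₁ (chunkStart (suc j))                                     ≡⟨ starts-chunkStart B₁ j ⟩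
      starts B₁ (chunkStart j) + countIn B₁ (chunk (stage j))            ≤⟨ +-mono-≤ (close j) (≤-reflexive (agree (≤-pred J<j))) ⟩
      D + starts B₂ (chunkStart j) + countIn B₂ (chunk (stage j))        ≡⟨ +-assoc D _ _ ⟩
      D + (starts B₂ (chunkStart j) + countIn B₂ (chunk (stage j)))      ≡⟨ cong (D +_) (starts-chunkStart B₂ j) ⟨
      D + starts B₂ (chunkStart (suc j))                                 ∎
      where open ≤-Reasoning

  -- Stated for any `E′` pointwise equal to `E`, so that it also covers the digits of an arbitrary
  -- expansion of the constructed number.
  startsWith⇒occursAt : ∀ {E′ : ℕ → ℕ} → (∀ i → E′ i ≡ E i) → ∀ (B : Vec ℕ k) {i xs} →
    pending i ≡ xs → 0 < startsWith B xs → OccursAt E′ B i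
  startsWith⇒occursAt E′≡E []      eq 0<s = refl
  startsWith⇒occursAt {E′ = E′} E′≡E (b ∷ B) {i} {just d ∷ xs} eq 0<s with b ≟ d
  ... | yes refl = occursAt-∷ E′ i (trans (E′≡E i) (cong (emit i) eq))
                     (startsWith⇒occursAt E′≡E B (pending-tail i eq) 0<s)

  -- From position `i` on every filler exceeds all digits of `B`, so an occurrence cannot use one.
  occursAt⇒startsWith : ∀ {m} (B : Vec ℕ k) → Vec.All (_< m) B → ∀ {i xs} → pending i ≡ xs →
    (∀ {h} → i ≤ h → m ≤ filler h) → OccursAt E B i → 0 < startsWith B xs
  occursAt⇒startsWith []      []          eq m≤ occ = z<s
  occursAt⇒startsWith (b ∷ B) (b<m ∷ B<m) {i} {[]} eq m≤ occ =
    contradiction (trans (sym (proj₁ (occursAt-∷⁻ E i occ))) (cong (emit i) eq)) (<⇒≢ (<-≤-trans b<m (m≤ ≤-refl)))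
  occursAt⇒startsWith (b ∷ B) (b<m ∷ B<m) {i} {nothing ∷ xs} eq m≤ occ =
    contradiction (trans (sym (proj₁ (occursAt-∷⁻ E i occ))) (cong (emit i) eq)) (<⇒≢ (<-≤-trans b<m (m≤ ≤-refl)))
  occursAt⇒startsWith (b ∷ B) (b<m ∷ B<m) {i} {just d ∷ xs} eq m≤ occ with b ≟ d
  ... | yes _  = occursAt⇒startsWith B B<m (pending-tail i eq) (λ i<h → m≤ (<⇒≤ i<h)) (proj₂ (occursAt-∷⁻ E i occ))
  ... | no b≢d = contradiction (trans (sym (proj₁ (occursAt-∷⁻ E i occ))) (cong (emit i) eq)) b≢d

  starts≤occurrences : ∀ {E′ : ℕ → ℕ} → (∀ i → E′ i ≡ E i) → ∀ (B : Vec ℕ k) n →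
    starts B n ≤ occurrences E′ B n
  starts≤occurrences E′≡E B zero    = z≤n
  starts≤occurrences {E′ = E′} E′≡E B (suc n) with startsWith B (pending n) in eq
  ... | zero  = begin
    starts B n + 0            ≡⟨ +-identityʳ _ ⟩
    starts B n                ≤⟨ starts≤occurrences E′≡E B n ⟩
    occurrences E′ B n        ≤⟨ occurrences-mono E′ B (n≤1+n n) ⟩
    occurrences E′ B (suc n)  ∎
    where open ≤-Reasoning
  ... | suc s = begin
    starts B n + suc s        ≤⟨ +-mono-≤ (starts≤occurrences E′≡E B n) (subst (_≤ 1) eq (startsWith≤1 B (pending n))) ⟩
    occurrences E′ B n + 1    ≡⟨ occurrences-hit E′ B (startsWith⇒occursAt E′≡E B {n} refl (subst (0 <_) (sym eq) z<s)) ⟨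
    occurrences E′ B (suc n)  ∎
    where open ≤-Reasoning

  occurrences≤starts : ∀ (B : Vec ℕ k) → ∃[ K ] ∀ n → occurrences E B n ≤ K + starts B n
  -- Terms of at least 2 + m make the fillers at least `m`; the positions before `K` contribute at
  -- most `K` occurrences.
  occurrences≤starts B with m , B<m ← bounded B with K , large ← Q→∞ (2 + m) = K , bound
    where
    bound : ∀ n → occurrences E B n ≤ K + starts B n
    bound zero    = z≤n
    bound (suc n) with ≤-<-connex (suc n) K
    ... | inj₁ n<K = ≤-trans (occurrences≤ E B (suc n)) (≤-trans n<K (m≤m+n K _))
    ... | inj₂ K≤n with occursAt? E B n
    ...   | no miss = begin
      occurrences E B (suc n)                      ≡⟨ occurrences-miss E B miss ⟩
      occurrences E B n                            ≤⟨ bound n ⟩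
      K + starts B n                               ≤⟨ +-monoʳ-≤ K (m≤m+n _ _) ⟩
      K + starts B (suc n)                         ∎
      where open ≤-Reasoning
    ...   | yes hit = begin
      occurrences E B (suc n)                      ≡⟨ occurrences-hit E B hit ⟩
      occurrences E B n + 1                        ≤⟨ +-mono-≤ (bound n) (occursAt⇒startsWith B B<m {n} refl filler-large hit) ⟩
      K + starts B n + startsWith B (pending n)    ≡⟨ +-assoc K _ _ ⟩
      K + starts B (suc n)                         ∎
      where
      open ≤-Reasoning
      filler-large : ∀ {h} → n ≤ h → m ≤ filler h
      filler-large {h} n≤h = ∸-monoˡ-≤ 2 (large h (≤-trans (≤-pred K≤n) n≤h))

  -- The chunk in progress is counted in full for `B₁` and not at all for `B₂`, which costs at most
  -- its size.
  occurrences-excess : ∀ (B₁ B₂ : Vec ℕ (suc k)) → ∃[ C ] ∀ j {n} → chunkStart j ≤ n → n < chunkStart (suc j) →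
    occurrences E B₁ n ≤ C + size (stage j) + occurrences E B₂ n
  occurrences-excess B₁ B₂ with K , occ≤ ← occurrences≤starts B₁ | D , close ← starts-close B₁ B₂ =
    K + D , excess
    where
    open ≤-Reasoning
    open +-*-Solver
    excess : ∀ j {n} → chunkStart j ≤ n → n < chunkStart (suc j) →
      occurrences E B₁ n ≤ K + D + size (stage j) + occurrences E B₂ n
    excess j {n} j≤n n<j+1 = begin
      occurrences E B₁ n                                      ≤⟨ occurrences-mono E B₁ (<⇒≤ n<j+1) ⟩
      occurrences E B₁ (chunkStart (suc j))                        ≤⟨ occ≤ (chunkStart (suc j)) ⟩
      K + starts B₁ (chunkStart (suc j))                           ≡⟨ cong (K +_) (starts-chunkStart B₁ j) ⟩
      K + (starts B₁ (chunkStart j) + count)                       ≤⟨ +-monoʳ-≤ K (+-mono-≤ (close j) (m≤n⇒m≤1+n (countIn≤length B₁ (chunk (stage j))))) ⟩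
      K + (D + starts B₂ (chunkStart j) + size (stage j))          ≡⟨ solve 4 (λ a b c d → a :+ (b :+ c :+ d) := a :+ b :+ d :+ c) refl K D (starts B₂ (chunkStart j)) (size (stage j)) ⟩
      K + D + size (stage j) + starts B₂ (chunkStart j)            ≤⟨ +-monoʳ-≤ (K + D + size (stage j)) (starts-mono B₂ j≤n) ⟩
      K + D + size (stage j) + starts B₂ n                    ≤⟨ +-monoʳ-≤ (K + D + size (stage j)) (starts≤occurrences (λ _ → refl) B₂ n) ⟩
      K + D + size (stage j) + occurrences E B₂ n             ∎
      where count = countIn B₁ (chunk (stage j))

  -- Here `c` stands for 1/ε. The difference of the counts is at most a constant plus the size of
  -- the current chunk, whereas `stage*size≤` makes the count of `B₂` exceed any fixed multiple of
  -- that size.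
  occurrences-close : ∀ (B₁ B₂ : Vec ℕ (suc k)) c → ∃[ N ] ∀ n → N ≤ n →
    c * ∣ occurrences E B₁ n - occurrences E B₂ n ∣ < occurrences E B₂ n
  occurrences-close B₁ B₂ c
    with C₁ , excess₁ ← occurrences-excess B₁ B₂ | C₂ , excess₂ ← occurrences-excess B₂ B₁
       | J , linear ← starts-linear B₂
    -- The required stage is the coefficient of `s` that the chain of inequalities below ends up
    -- with.
    with j₀ , stage-large ← stage-unbounded (c * (C₁ + C₂) + c + J + 1) =
    chunkStart j₀ , bound
    where
    bound : ∀ n → chunkStart j₀ ≤ n → c * ∣ occurrences E B₁ n - occurrences E B₂ n ∣ < occurrences E B₂ n
    bound n j₀≤n with j , j≤n , n<j+1 ← locate n = +-cancelˡ-< J _ _ (begin-strict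
      J + c * ∣ occurrences E B₁ n - occurrences E B₂ n ∣
        ≤⟨ +-monoʳ-≤ J (*-monoʳ-≤ c (∣-∣-bound {c = C₁ + C₂ + s}
             (≤-trans (excess₁ j j≤n n<j+1) (+-monoˡ-≤ _ (+-monoˡ-≤ s (m≤m+n C₁ C₂))))
             (≤-trans (excess₂ j j≤n n<j+1) (+-monoˡ-≤ _ (+-monoˡ-≤ s (m≤n+m C₂ C₁)))))) ⟩
      J + c * (C₁ + C₂ + s)                      <⟨ n<1+n _ ⟩
      suc (J + c * (C₁ + C₂ + s))                ≡⟨ solve 4 (λ J c C s → con 1 :+ (J :+ c :* (C :+ s)) := c :* C :+ c :* s :+ J :+ con 1) refl J c (C₁ + C₂) s ⟩
      -- Each summand without a factor `s` receives one, as s ≥ 1, so that `s` can be taken out.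
      c * (C₁ + C₂) + c * s + J + 1              ≤⟨ +-mono-≤ (+-mono-≤ (+-monoˡ-≤ (c * s) (m≤m*n (c * (C₁ + C₂)) s)) (m≤m*n J s)) (m≤m*n 1 s) ⟩
      c * (C₁ + C₂) * s + c * s + J * s + 1 * s  ≡⟨ solve 4 (λ x c J s → x :* s :+ c :* s :+ J :* s :+ con 1 :* s := (x :+ c :+ J :+ con 1) :* s) refl (c * (C₁ + C₂)) c J s ⟩
      (c * (C₁ + C₂) + c + J + 1) * s            ≤⟨ *-monoˡ-≤ s (stage-large j₀≤j) ⟩
      stage j * s                                ≤⟨ stage*size≤ j ⟩
      j                                          ≤⟨ linear j ⟩
      J + starts B₂ (chunkStart j)                    ≤⟨ +-monoʳ-≤ J (starts-mono B₂ j≤n) ⟩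
      J + starts B₂ n                            ≤⟨ +-monoʳ-≤ J (starts≤occurrences (λ _ → refl) B₂ n) ⟩
      J + occurrences E B₂ n                     ∎)
      where
      open ≤-Reasoning
      open +-*-Solver
      s = size (stage j)
      j₀≤j : j₀ ≤ j
      j₀≤j with ≤-<-connex j₀ j
      ... | inj₁ j₀≤j = j₀≤j
      ... | inj₂ j<j₀ = contradiction (<-≤-trans n<j+1 (≤-trans (chunkStart-mono j<j₀) j₀≤n)) (<-irrefl refl)

-- Inequalities and embeddings in the rationals.

-- The equation says p′ − q′ = p − q.
≤-shift : ∀ {p q p′ q′} → p ℚ.≤ q → p′ ℚ.+ q ≡ q′ ℚ.+ p → p′ ℚ.≤ q′
≤-shift {p} {q} {p′} {q′} p≤q eq = begin
  p′                    ≡⟨ solve 2 (λ a b → a := a :+ b :+ :- b) refl p′ q ⟩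
  p′ ℚ.+ q ℚ.- q        ≡⟨ cong (ℚ._- q) eq ⟩
  q′ ℚ.+ p ℚ.- q        ≤⟨ ℚ.+-monoˡ-≤ (ℚ.- q) (ℚ.+-monoʳ-≤ q′ p≤q) ⟩
  q′ ℚ.+ q ℚ.- q        ≡⟨ solve 2 (λ a b → a :+ b :+ :- b := a) refl q′ q ⟩
  q′                    ∎
  where
  open ℚ.≤-Reasoning
  open ℚ-Solver.+-*-Solver

<-shift : ∀ {p q p′ q′} → p ℚ.< q → p′ ℚ.+ q ≡ q′ ℚ.+ p → p′ ℚ.< q′
<-shift {p} {q} {p′} {q′} p<q eq = begin-strict
  p′                    ≡⟨ solve 2 (λ a b → a := a :+ b :+ :- b) refl p′ q ⟩
  p′ ℚ.+ q ℚ.- q        ≡⟨ cong (ℚ._- q) eq ⟩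
  q′ ℚ.+ p ℚ.- q        <⟨ ℚ.+-monoˡ-< (ℚ.- q) (ℚ.+-monoʳ-< q′ p<q) ⟩
  q′ ℚ.+ q ℚ.- q        ≡⟨ solve 2 (λ a b → a :+ b :+ :- b := a) refl q′ q ⟩
  q′                    ∎
  where
  open ℚ.≤-Reasoning
  open ℚ-Solver.+-*-Solver

abs-≤ : ∀ {p q r} → p ℚ.≤ q ℚ.+ r → q ℚ.≤ p ℚ.+ r → abs (p ℚ.- q) ℚ.≤ r
abs-≤ {p} {q} {r} p≤ q≤ with ℚ.∣p∣≡p∨∣p∣≡-p (p ℚ.- q)
... | inj₁ eq = subst (ℚ._≤ r) (sym eq) (≤-shift p≤ (solve 3 (λ p q r → p :+ :- q :+ (q :+ r) := r :+ p) refl p q r))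
  where open ℚ-Solver.+-*-Solver
... | inj₂ eq = subst (ℚ._≤ r) (sym eq) (≤-shift q≤ (solve 3 (λ p q r → :- (p :+ :- q) :+ (p :+ r) := r :+ q) refl p q r))
  where open ℚ-Solver.+-*-Solver

p≤abs : ∀ p → p ℚ.≤ abs p
p≤abs p with ℚ.∣p∣≡p∨∣p∣≡-p p
... | inj₁ eq = ℚ.≤-reflexive (sym eq)
... | inj₂ eq = ℚ.≤-trans (≤-shift (subst (0ℚ ℚ.≤_) eq (ℚ.0≤∣p∣ p)) (solve 1 (λ p → p :+ :- p := con 0ℚ :+ con 0ℚ) refl p)) (ℚ.0≤∣p∣ p)
  where open ℚ-Solver.+-*-Solver

fromℚᵘ-homo-* : ∀ p q → ℚ.fromℚᵘ (p ℚᵘ.* q) ≡ ℚ.fromℚᵘ p ℚ.* ℚ.fromℚᵘ q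
fromℚᵘ-homo-* p q = ℚ.toℚᵘ-injective (begin
  ℚ.toℚᵘ (ℚ.fromℚᵘ (p ℚᵘ.* q))                       ≈⟨ ℚ.toℚᵘ-fromℚᵘ (p ℚᵘ.* q) ⟩
  p ℚᵘ.* q                                           ≈⟨ ℚᵘ.*-cong (ℚ.toℚᵘ-fromℚᵘ p) (ℚ.toℚᵘ-fromℚᵘ q) ⟨
  ℚ.toℚᵘ (ℚ.fromℚᵘ p) ℚᵘ.* ℚ.toℚᵘ (ℚ.fromℚᵘ q)       ≈⟨ ℚ.toℚᵘ-homo-* (ℚ.fromℚᵘ p) (ℚ.fromℚᵘ q) ⟨
  ℚ.toℚᵘ (ℚ.fromℚᵘ p ℚ.* ℚ.fromℚᵘ q)                 ∎)
  where open import Relation.Binary.Reasoning.Setoid ℚᵘ.≃-setoid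

fromℚᵘ-homo-+ : ∀ p q → ℚ.fromℚᵘ (p ℚᵘ.+ q) ≡ ℚ.fromℚᵘ p ℚ.+ ℚ.fromℚᵘ q
fromℚᵘ-homo-+ p q = ℚ.toℚᵘ-injective (begin
  ℚ.toℚᵘ (ℚ.fromℚᵘ (p ℚᵘ.+ q))                       ≈⟨ ℚ.toℚᵘ-fromℚᵘ (p ℚᵘ.+ q) ⟩
  p ℚᵘ.+ q                                           ≈⟨ ℚᵘ.+-cong (ℚ.toℚᵘ-fromℚᵘ p) (ℚ.toℚᵘ-fromℚᵘ q) ⟨
  ℚ.toℚᵘ (ℚ.fromℚᵘ p) ℚᵘ.+ ℚ.toℚᵘ (ℚ.fromℚᵘ q)       ≈⟨ ℚ.toℚᵘ-homo-+ (ℚ.fromℚᵘ p) (ℚ.fromℚᵘ q) ⟨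
  ℚ.toℚᵘ (ℚ.fromℚᵘ p ℚ.+ ℚ.fromℚᵘ q)                 ∎)
  where open import Relation.Binary.Reasoning.Setoid ℚᵘ.≃-setoid

/1-homo-+ : ∀ i j → (i ℤ.+ j) / 1 ≡ i / 1 ℚ.+ j / 1
/1-homo-+ i j = trans (ℚ.fromℚᵘ-cong {mkℚᵘ (i ℤ.+ j) 0} {mkℚᵘ i 0 ℚᵘ.+ mkℚᵘ j 0} (*≡* (solve 2 (λ i j → (i :+ j) :* con ℤ.1ℤ := (i :* con ℤ.1ℤ :+ j :* con ℤ.1ℤ) :* con ℤ.1ℤ) refl i j)))
  (fromℚᵘ-homo-+ (mkℚᵘ i 0) (mkℚᵘ j 0))
  where open ℤ-Solver.+-*-Solver

/1-cancel-< : ∀ {i j} → i / 1 ℚ.< j / 1 → i ℤ.< j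
/1-cancel-< {i} {j} i<j with ℚᵘ.*<* lt ← ℚᵘ.<-respˡ-≃ (ℚ.toℚᵘ-fromℚᵘ (mkℚᵘ i 0)) (ℚᵘ.<-respʳ-≃ (ℚ.toℚᵘ-fromℚᵘ (mkℚᵘ j 0)) (ℚ.toℚᵘ-mono-< i<j)) =
  ℤ.*-cancelʳ-<-nonNeg ℤ.1ℤ lt

/1-mono-< : ∀ {i j} → i ℤ.< j → i / 1 ℚ.< j / 1
/1-mono-< {i} {j} i<j = ℚ.toℚᵘ-cancel-<
  (ℚᵘ.<-respˡ-≃ (ℚᵘ.≃-sym (ℚ.toℚᵘ-fromℚᵘ (mkℚᵘ i 0)))
  (ℚᵘ.<-respʳ-≃ (ℚᵘ.≃-sym (ℚ.toℚᵘ-fromℚᵘ (mkℚᵘ j 0)))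
  (ℚᵘ.*<* (ℤ.*-monoʳ-<-pos ℤ.1ℤ i<j))))

-- Opaque, since the conversion checker would otherwise unfold the coprimality proofs inside ℚ.
opaque

  ι : ℕ → ℚ
  ι n = (ℤ.+ n) / 1

  recip : ∀ d → .{{_ : NonZero d}} → ℚ
  recip d = ℤ.1ℤ / d

opaque
  unfolding ι recip

  ι-/1 : ∀ n → (ℤ.+ n) / 1 ≡ ι n
  ι-/1 n = refl

  ι-1 : ι 1 ≡ 1ℚ
  ι-1 = refl

  ι-0 : ι 0 ≡ 0ℚ
  ι-0 = refl

  recip-1 : recip 1 ≡ 1ℚ
  recip-1 = refl

  recip-/ : ∀ d .{{_ : NonZero d}} → (ℤ.+ 1) / d ≡ recip d
  recip-/ d = refl

  ι-homo-+ : ∀ m n → ι (m + n) ≡ ι m ℚ.+ ι n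
  ι-homo-+ m n = /1-homo-+ (ℤ.+ m) (ℤ.+ n)

  ι-homo-* : ∀ m n → ι (m * n) ≡ ι m ℚ.* ι n
  ι-homo-* m n = trans
    (ℚ.fromℚᵘ-cong {mkℚᵘ (ℤ.+ (m * n)) 0} {mkℚᵘ (ℤ.+ m) 0 ℚᵘ.* mkℚᵘ (ℤ.+ n) 0} (*≡* (cong (ℤ._* ℤ.1ℤ) (ℤ.pos-* m n))))
    (fromℚᵘ-homo-* (mkℚᵘ (ℤ.+ m) 0) (mkℚᵘ (ℤ.+ n) 0))

  ι-mono-< : ∀ {m n} → m < n → ι m ℚ.< ι n
  ι-mono-< m<n = /1-mono-< (ℤ.+<+ m<n)

  ι-cancel-< : ∀ {m n} → ι m ℚ.< ι n → m < n
  ι-cancel-< lt = ℤ.drop‿+<+ (/1-cancel-< lt)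

  ι-mono-≤ : ∀ {m n} → m ≤ n → ι m ℚ.≤ ι n
  ι-mono-≤ m≤n = ℚ.≮⇒≥ λ n<m → ≤⇒≯ m≤n (ι-cancel-< n<m)

  ι-cancel-≤ : ∀ {m n} → ι m ℚ.≤ ι n → m ≤ n
  ι-cancel-≤ m≤n = ≮⇒≥ λ n<m → ℚ.<-irrefl refl (ℚ.<-≤-trans (ι-mono-< n<m) m≤n)

  ι-nonNeg : ∀ n → ℚ.NonNegative (ι n)
  ι-nonNeg n = ℚ.normalize-nonNeg n 1

  /-as-* : ∀ n d .{{_ : NonZero d}} → (ℤ.+ n) / d ≡ ι n ℚ.* recip d
  /-as-* n d@(suc d-1) = trans
    (ℚ.fromℚᵘ-cong {mkℚᵘ (ℤ.+ n) d-1} {mkℚᵘ (ℤ.+ n) 0 ℚᵘ.* mkℚᵘ ℤ.1ℤ d-1} (*≡* (cong₂ ℤ._*_ (sym (ℤ.*-identityʳ (ℤ.+ n))) (cong ℤ.+_ (+-identityʳ d)))))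
    (fromℚᵘ-homo-* (mkℚᵘ (ℤ.+ n) 0) (mkℚᵘ ℤ.1ℤ d-1))

  ι-inverse : ∀ d .{{_ : NonZero d}} → ι d ℚ.* recip d ≡ 1ℚ
  ι-inverse d@(suc d-1) = trans (sym (fromℚᵘ-homo-* (mkℚᵘ (ℤ.+ d) 0) (mkℚᵘ ℤ.1ℤ d-1)))
    (ℚ.fromℚᵘ-cong {mkℚᵘ (ℤ.+ d) 0 ℚᵘ.* mkℚᵘ ℤ.1ℤ d-1} {mkℚᵘ ℤ.1ℤ 0}
      (*≡* (trans (ℤ.*-identityʳ _) (trans (ℤ.*-identityʳ (ℤ.+ d)) (cong ℤ.+_ (sym (trans (+-identityʳ _) (+-identityʳ d))))))))

  recip-pos : ∀ d .{{_ : NonZero d}} → ℚ.Positive (recip d)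
  recip-pos d = ℚ.normalize-pos 1 d

recip-* : ∀ a b .{{_ : NonZero a}} .{{_ : NonZero (a * b)}} → recip a ≡ ι b ℚ.* recip (a * b)
recip-* a b = begin
  recip a                                                     ≡⟨ ℚ.*-identityʳ _ ⟨
  recip a ℚ.* 1ℚ                                              ≡⟨ cong (recip a ℚ.*_) (ι-inverse (a * b)) ⟨
  recip a ℚ.* (ι (a * b) ℚ.* recip (a * b))                ≡⟨ cong (λ x → recip a ℚ.* (x ℚ.* recip (a * b))) (ι-homo-* a b) ⟩
  recip a ℚ.* (ι a ℚ.* ι b ℚ.* recip (a * b))              ≡⟨ solve 4 (λ r a b s → r :* (a :* b :* s) := a :* r :* (b :* s)) refl (recip a) (ι a) (ι b) (recip (a * b)) ⟩
  ι a ℚ.* recip a ℚ.* (ι b ℚ.* recip (a * b))            ≡⟨ cong (ℚ._* (ι b ℚ.* recip (a * b))) (ι-inverse a) ⟩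
  1ℚ ℚ.* (ι b ℚ.* recip (a * b))                            ≡⟨ ℚ.*-identityˡ _ ⟩
  ι b ℚ.* recip (a * b)                                     ∎
  where
  open ≡-Reasoning
  open ℚ-Solver.+-*-Solver

opaque

  -- The denominator of ε serves as `b`: the product is then the numerator, a positive integer.
  archimedean : ∀ {ε} → 0ℚ ℚ.< ε → ∃[ b ] 1ℚ ℚ.≤ ε ℚ.* ι b
  archimedean {ε} 0<ε with ℚ.↥ ε in eq | ℚ.positive 0<ε
  archimedean {ε@(ℚ.mkℚ (ℤ.+ suc a) d-1 _)} 0<ε | _ | _ = suc d-1 , (begin
    1ℚ                                            ≡⟨ ι-1 ⟨
    ι 1                                           ≤⟨ ι-mono-≤ {1} {suc a} (s≤s z≤n) ⟩
    ι (suc a)                                     ≡⟨ ℚ.*-identityʳ _ ⟨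
    ι (suc a) ℚ.* 1ℚ                              ≡⟨ cong (ι (suc a) ℚ.*_) (ι-inverse (suc d-1)) ⟨
    ι (suc a) ℚ.* (ι (suc d-1) ℚ.* recip (suc d-1)) ≡⟨ solve 3 (λ a d r → a :* (d :* r) := a :* r :* d) refl (ι (suc a)) (ι (suc d-1)) (recip (suc d-1)) ⟩
    ι (suc a) ℚ.* recip (suc d-1) ℚ.* ι (suc d-1) ≡⟨ cong (ℚ._* ι (suc d-1)) (/-as-* (suc a) (suc d-1)) ⟨
    (ℤ.+ suc a) / suc d-1 ℚ.* ι (suc d-1)           ≡⟨ cong (ℚ._* ι (suc d-1)) (ℚ.↥p/↧p≡p ε) ⟩
    ε ℚ.* ι (suc d-1)                             ∎)
    where
    open ℚ.≤-Reasoning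
    open ℚ-Solver.+-*-Solver

<ᴿ-≤-trans : ∀ x {p q} → x <ᴿ fromℚ p → p ℚ.≤ q → x <ᴿ fromℚ q
<ᴿ-≤-trans x (δ , 0<δ , N , below) p≤q = δ , 0<δ , N , λ n N≤n → ℚ.<-≤-trans (below n N≤n) p≤q

-- Convergence of Cantor series and the nested intervals [S n, S n + unit n].

module Sums (Q : BasicSequence) (w : ℤ) (E : ℕ → ℕ) (E<term : ∀ i → E i < term Q i) where

  opaque

    S : ℕ → ℚ
    S = partialSum Q w E

  unit : ℕ → ℚ
  unit n = recip (prod Q 0 n) {{prod≢0 Q 0 n}}

  unit-pos : ∀ n → ℚ.Positive (unit n)
  unit-pos n = recip-pos (prod Q 0 n) {{prod≢0 Q 0 n}}

  0<unit : ∀ n → 0ℚ ℚ.< unit n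
  0<unit n = ℚ.positive⁻¹ (unit n) {{unit-pos n}}

  unit-suc : ∀ n → unit n ≡ ι (term Q n) ℚ.* unit (suc n)
  unit-suc n = recip-* (prod Q 0 n) (term Q n) {{prod≢0 Q 0 n}} {{prod≢0 Q 0 (suc n)}}

  opaque
    unfolding S

    S-zero : S 0 ≡ w / 1
    S-zero = ℚ.+-identityʳ (w / 1)

    S-suc : ∀ n → S (suc n) ≡ S n ℚ.+ ι (E n) ℚ.* unit (suc n)
    S-suc n = trans (sym (ℚ.+-assoc (w / 1) _ _))
      (cong (S n ℚ.+_) (/-as-* (E n) (prod Q 0 (suc n)) {{prod≢0 Q 0 (suc n)}}))

    partialSum⟶⇒S⟶ : ∀ x → partialSum Q w E ⟶ x → S ⟶ x
    partialSum⟶⇒S⟶ x S⟶x = S⟶x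

    S⟶⇒partialSum⟶ : ∀ x → S ⟶ x → partialSum Q w E ⟶ x
    S⟶⇒partialSum⟶ x S⟶x = S⟶x

  S+unit-zero : S 0 ℚ.+ unit 0 ≡ (w ℤ.+ ℤ.1ℤ) / 1
  S+unit-zero = trans (cong₂ ℚ._+_ S-zero recip-1) (sym (/1-homo-+ w ℤ.1ℤ))

  ι*unit-mono : ∀ {a b} n → a ≤ b → ι a ℚ.* unit n ℚ.≤ ι b ℚ.* unit n
  ι*unit-mono n a≤b = ℚ.*-monoʳ-≤-nonNeg (unit n) {{ℚ.pos⇒nonNeg (unit n) {{unit-pos n}}}} (ι-mono-≤ a≤b)

  S-step : ∀ n → S n ℚ.≤ S (suc n)
  S-step n = begin
    S n                                  ≡⟨ solve 2 (λ s u → s := s :+ con 0ℚ :* u) refl (S n) (unit (suc n)) ⟩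
    S n ℚ.+ 0ℚ ℚ.* unit (suc n)          ≡⟨ cong (λ z → S n ℚ.+ z ℚ.* unit (suc n)) ι-0 ⟨
    S n ℚ.+ ι 0 ℚ.* unit (suc n)         ≤⟨ ℚ.+-monoʳ-≤ (S n) (ι*unit-mono {0} {E n} (suc n) z≤n) ⟩
    S n ℚ.+ ι (E n) ℚ.* unit (suc n)     ≡⟨ S-suc n ⟨
    S (suc n)                            ∎
    where
    open ℚ.≤-Reasoning
    open ℚ-Solver.+-*-Solver

  -- With c = 1 the right ends of the intervals decrease; with c = 2, available at a non-maximal
  -- digit, one unit of the finer scale is left over.
  S+unit-bound : ∀ c n → E n + c ≤ term Q n → S (suc n) ℚ.+ ι c ℚ.* unit (suc n) ℚ.≤ S n ℚ.+ unit n
  S+unit-bound c n E+c≤ = begin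
    S (suc n) ℚ.+ ι c ℚ.* u                            ≡⟨ cong (ℚ._+ ι c ℚ.* u) (S-suc n) ⟩
    S n ℚ.+ ι (E n) ℚ.* u ℚ.+ ι c ℚ.* u                ≡⟨ solve 4 (λ s e c u → s :+ e :* u :+ c :* u := s :+ (e :+ c) :* u) refl (S n) (ι (E n)) (ι c) u ⟩
    S n ℚ.+ (ι (E n) ℚ.+ ι c) ℚ.* u                    ≡⟨ cong (λ x → S n ℚ.+ x ℚ.* u) (ι-homo-+ (E n) c) ⟨
    S n ℚ.+ ι (E n + c) ℚ.* u                          ≤⟨ ℚ.+-monoʳ-≤ (S n) (ι*unit-mono (suc n) E+c≤) ⟩
    S n ℚ.+ ι (term Q n) ℚ.* u                         ≡⟨ cong (S n ℚ.+_) (unit-suc n) ⟨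
    S n ℚ.+ unit n                                     ∎
    where
    open ℚ.≤-Reasoning
    open ℚ-Solver.+-*-Solver
    u = unit (suc n)

  S+unit-step : ∀ n → S (suc n) ℚ.+ unit (suc n) ℚ.≤ S n ℚ.+ unit n
  S+unit-step n = subst (λ x → S (suc n) ℚ.+ x ℚ.≤ S n ℚ.+ unit n) (trans (cong (ℚ._* unit (suc n)) ι-1) (ℚ.*-identityˡ (unit (suc n))))
    (S+unit-bound 1 n (≤-trans (≤-reflexive (+-comm (E n) 1)) (E<term n)))

  S-mono : ∀ {m n} → m ≤ n → S m ℚ.≤ S n
  S-mono = chain {_∼_ = ℚ._≤_} ℚ.≤-refl ℚ.≤-trans S S-step

  S+unit-anti : ∀ {m n} → m ≤ n → S n ℚ.+ unit n ℚ.≤ S m ℚ.+ unit m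
  S+unit-anti = chain {_∼_ = λ p q → q ℚ.≤ p} ℚ.≤-refl (flip ℚ.≤-trans) (λ n → S n ℚ.+ unit n) S+unit-step

  S≤S+unit : ∀ m n → S m ℚ.≤ S n ℚ.+ unit n
  S≤S+unit m n = begin
    S m                                  ≤⟨ S-mono (m≤m⊔n m n) ⟩
    S (m ⊔ n)                            ≡⟨ ℚ.+-identityʳ _ ⟨
    S (m ⊔ n) ℚ.+ 0ℚ                     ≤⟨ ℚ.+-monoʳ-≤ (S (m ⊔ n)) (ℚ.<⇒≤ (0<unit (m ⊔ n))) ⟩
    S (m ⊔ n) ℚ.+ unit (m ⊔ n)           ≤⟨ S+unit-anti (m≤n⊔m m n) ⟩
    S n ℚ.+ unit n                       ∎
    where open ℚ.≤-Reasoning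

  S-close : ∀ {N m n} → N ≤ m → N ≤ n → S m ℚ.≤ S n ℚ.+ unit N
  S-close {N} {m} N≤m N≤n = ℚ.≤-trans (S≤S+unit m N) (ℚ.+-monoˡ-≤ (unit N) (S-mono N≤n))

  n<prod : ∀ n → n < prod Q 0 n
  n<prod zero    = z<s
  n<prod (suc n) = begin-strict
    suc n                        ≤⟨ n<prod n ⟩
    prod Q 0 n                   <⟨ m<m*n (prod Q 0 n) (term Q n) {{prod≢0 Q 0 n}} (2≤term Q n) ⟩
    prod Q 0 n * term Q n        ∎
    where open ≤-Reasoning

  opaque

    unit-small : ∀ {ε} → 0ℚ ℚ.< ε → ∃[ N ] unit N ℚ.< ε
    unit-small {ε} 0<ε with b , 1≤εb ← archimedean 0<ε = b , (begin-strict
      unit b                                ≡⟨ ℚ.*-identityʳ _ ⟨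
      unit b ℚ.* 1ℚ                         ≤⟨ ℚ.*-monoˡ-≤-nonNeg (unit b) {{ℚ.pos⇒nonNeg (unit b) {{unit-pos b}}}} 1≤εb ⟩
      unit b ℚ.* (ε ℚ.* ι b)                <⟨ ℚ.*-monoʳ-<-pos (unit b) {{unit-pos b}} (ℚ.*-monoʳ-<-pos ε {{ℚ.positive 0<ε}} (ι-mono-< (n<prod b))) ⟩
      unit b ℚ.* (ε ℚ.* ι (prod Q 0 b))     ≡⟨ solve 3 (λ u e p → u :* (e :* p) := e :* (p :* u)) refl (unit b) ε (ι (prod Q 0 b)) ⟩
      ε ℚ.* (ι (prod Q 0 b) ℚ.* unit b)     ≡⟨ cong (ε ℚ.*_) (ι-inverse (prod Q 0 b) {{prod≢0 Q 0 b}}) ⟩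
      ε ℚ.* 1ℚ                              ≡⟨ ℚ.*-identityʳ ε ⟩
      ε                                     ∎)
      where
      open ℚ.≤-Reasoning
      open ℚ-Solver.+-*-Solver

  limit : ℝ
  limit .seq    = S
  limit .cauchy ε 0<ε with N , unit<ε ← unit-small 0<ε =
    N , λ m n N≤m N≤n → ℚ.≤-<-trans (abs-≤ (S-close N≤m N≤n) (S-close N≤n N≤m)) unit<ε

  S⟶limit : S ⟶ limit
  -- One half of ε absorbs the distance of the partial sums, the other is the margin that `_<ᴿ_`
  -- demands.
  S⟶limit ε 0<ε with N , unit<½ε ← unit-small {½ ℚ.* ε} (ℚ.*-monoʳ-<-pos ½ 0<ε) =
    N , λ n N≤n →
      (½ ℚ.* ε , ℚ.*-monoʳ-<-pos ½ 0<ε , N , λ k N≤k →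
        <-shift (ℚ.≤-<-trans (S-close N≤n N≤k) (ℚ.+-monoʳ-< (S k) unit<½ε))
          (solve 3 (λ s t e → s :+ :- e :+ con ½ :* e :+ (t :+ con ½ :* e) := t :+ s) refl (S n) (S k) ε)) ,
      (½ ℚ.* ε , ℚ.*-monoʳ-<-pos ½ 0<ε , N , λ k N≤k →
        <-shift (ℚ.≤-<-trans (S-close N≤k N≤n) (ℚ.+-monoʳ-< (S n) unit<½ε))
          (solve 3 (λ s t e → t :+ con ½ :* e :+ (s :+ con ½ :* e) := s :+ e :+ t) refl (S n) (S k) ε))
    where open ℚ-Solver.+-*-Solver

  module Limit (not-max : ∀ N → ∃[ i ] (N ≤ i × E i ≢ term Q i ∸ 1)) {x : ℝ} (S⟶x : S ⟶ x) where

    S≤x : ∀ n → fromℚ (S n) ≤ᴿ x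
    S≤x n (δ , 0<δ , K , below) with N , close ← S⟶x δ 0<δ
      with (δ′ , 0<δ′ , K′ , above) , _ ← close (N ⊔ n) (m≤m⊔n N n) =
      ℚ.<-irrefl refl (begin-strict
        S (N ⊔ n)                     ≡⟨ solve 2 (λ s d → s := s :+ :- d :+ con 0ℚ :+ d) refl (S (N ⊔ n)) δ ⟩
        S (N ⊔ n) ℚ.- δ ℚ.+ 0ℚ ℚ.+ δ  <⟨ ℚ.+-monoˡ-< δ (ℚ.+-monoʳ-< (S (N ⊔ n) ℚ.- δ) 0<δ′) ⟩
        S (N ⊔ n) ℚ.- δ ℚ.+ δ′ ℚ.+ δ  <⟨ ℚ.+-monoˡ-< δ (above (K ⊔ K′) (m≤n⊔m K K′)) ⟩
        seq x (K ⊔ K′) ℚ.+ δ          <⟨ below (K ⊔ K′) (m≤m⊔n K K′) ⟩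
        S n                           ≤⟨ S-mono (m≤n⊔m N n) ⟩
        S (N ⊔ n)                     ∎)
      where
      open ℚ.≤-Reasoning
      open ℚ-Solver.+-*-Solver

    -- Strictness comes from a non-maximal digit at some i ≥ n: the spare `unit (suc i)` it leaves
    -- is used as the tolerance in the convergence to `x`.
    x<S+unit : ∀ n → x <ᴿ fromℚ (S n ℚ.+ unit n)
    x<S+unit n with i , n≤i , Ei≢ ← not-max n
      with N , close ← S⟶x (unit (suc i)) (0<unit (suc i)) =
      <ᴿ-≤-trans x (proj₂ (close (N ⊔ suc i) (m≤m⊔n N (suc i)))) (begin
        S (N ⊔ suc i) ℚ.+ u                          ≤⟨ ℚ.+-monoˡ-≤ u (S≤S+unit (N ⊔ suc i) (suc i)) ⟩
        S (suc i) ℚ.+ u ℚ.+ u                        ≡⟨ solve 2 (λ s u → s :+ u :+ u := s :+ (con 1ℚ :+ con 1ℚ) :* u) refl (S (suc i)) u ⟩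
        S (suc i) ℚ.+ (1ℚ ℚ.+ 1ℚ) ℚ.* u              ≡⟨ cong (λ c → S (suc i) ℚ.+ c ℚ.* u) (trans (ι-homo-+ 1 1) (cong₂ ℚ._+_ ι-1 ι-1)) ⟨
        S (suc i) ℚ.+ ι 2 ℚ.* u                      ≤⟨ S+unit-bound 2 i gap ⟩
        S i ℚ.+ unit i                               ≤⟨ S+unit-anti n≤i ⟩
        S n ℚ.+ unit n                               ∎)
      where
      open ℚ.≤-Reasoning
      open ℚ-Solver.+-*-Solver
      u = unit (suc i)
      gap : E i + 2 ≤ term Q i
      gap with m≤n⇒m<n∨m≡n (E<term i)
      ... | inj₁ <q = ≤-trans (≤-reflexive (+-comm (E i) 2)) <q
      ... | inj₂ ≡q = contradiction (cong (_∸ 1) ≡q) Ei≢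

    whole≤ᴿ : fromℚ (w / 1) ≤ᴿ x
    whole≤ᴿ = subst (λ p → fromℚ p ≤ᴿ x) S-zero (S≤x 0)

    <ᴿwhole+1 : x <ᴿ fromℚ ((w ℤ.+ ℤ.1ℤ) / 1)
    <ᴿwhole+1 = subst (λ p → x <ᴿ fromℚ p) S+unit-zero (x<S+unit 0)

-- Uniqueness of the expansion.

module Uniqueness {Q : BasicSequence} {x : ℝ} where

  module Of (e : Expansion Q x) where
    open Sums Q (whole e) (digit e) (digit<term e) public
    open Limit (not-maximal e) {x} (partialSum⟶⇒S⟶ x (converges e)) public

  -- The number `x` lies between the two sides; the conclusion is a comparison of rationals, which
  -- is decidable.
  S<S+unit : ∀ (e f : Expansion Q x) n → Of.S e n ℚ.< Of.S f n ℚ.+ Of.unit f n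
  S<S+unit e f n = ℚ.≰⇒> λ above → Of.S≤x e n (<ᴿ-≤-trans x (Of.x<S+unit f n) above)

  whole≤ : ∀ (e f : Expansion Q x) → whole e ℤ.≤ whole f
  whole≤ e f = ℤ.≮⇒≥ λ f<e → ℤ.<-irrefl refl (ℤ.<-≤-trans
    (/1-cancel-< {whole e} {whole f ℤ.+ ℤ.1ℤ} (subst₂ ℚ._<_ (Of.S-zero e) (Of.S+unit-zero f) (S<S+unit e f 0)))
    (subst (ℤ._≤ whole e) (ℤ.+-comm ℤ.1ℤ (whole f)) (ℤ.i<j⇒suc[i]≤j f<e)))

  -- After equal partial sums, `S<S+unit` at the next index says that the digit of `e` is less than
  -- the digit of `f` plus one, in multiples of `u`.
  digit≤ : ∀ (e f : Expansion Q x) n → Of.S e n ≡ Of.S f n → digit e n ≤ digit f n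
  digit≤ e f n Se≡Sf = ≤-pred (subst (digit e n <_) (+-comm (digit f n) 1)
    (ι-cancel-< (ℚ.*-cancelʳ-<-nonNeg u {{ℚ.pos⇒nonNeg u {{Of.unit-pos f (suc n)}}}} (<-shift (S<S+unit e f (suc n)) balance))))
    where
    open ≡-Reasoning
    open ℚ-Solver.+-*-Solver
    u = Of.unit f (suc n)
    balance : ι (digit e n) ℚ.* u ℚ.+ (Of.S f (suc n) ℚ.+ u) ≡ ι (digit f n + 1) ℚ.* u ℚ.+ Of.S e (suc n)
    balance = begin
      ι (digit e n) ℚ.* u ℚ.+ (Of.S f (suc n) ℚ.+ u)
        ≡⟨ cong (λ s → ι (digit e n) ℚ.* u ℚ.+ (s ℚ.+ u)) (Of.S-suc f n) ⟩
      ι (digit e n) ℚ.* u ℚ.+ (Of.S f n ℚ.+ ι (digit f n) ℚ.* u ℚ.+ u)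
        ≡⟨ solve 4 (λ d s c u → d :* u :+ (s :+ c :* u :+ u) := (c :+ con 1ℚ) :* u :+ (s :+ d :* u)) refl (ι (digit e n)) (Of.S f n) (ι (digit f n)) u ⟩
      (ι (digit f n) ℚ.+ 1ℚ) ℚ.* u ℚ.+ (Of.S f n ℚ.+ ι (digit e n) ℚ.* u)
        ≡⟨ cong₂ (λ a s → a ℚ.* u ℚ.+ (s ℚ.+ ι (digit e n) ℚ.* u)) (sym (trans (ι-homo-+ (digit f n) 1) (cong (ι (digit f n) ℚ.+_) ι-1))) (sym Se≡Sf) ⟩
      ι (digit f n + 1) ℚ.* u ℚ.+ (Of.S e n ℚ.+ ι (digit e n) ℚ.* u)
        ≡⟨ cong (ι (digit f n + 1) ℚ.* u ℚ.+_) (Of.S-suc e n) ⟨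
      ι (digit f n + 1) ℚ.* u ℚ.+ Of.S e (suc n) ∎

  S-unique : ∀ (e f : Expansion Q x) n → Of.S e n ≡ Of.S f n
  S-unique e f zero    = trans (Of.S-zero e) (trans (cong (_/ 1) (ℤ.≤-antisym (whole≤ e f) (whole≤ f e))) (sym (Of.S-zero f)))
  S-unique e f (suc n) = trans (Of.S-suc e n)
    (trans (cong₂ (λ s d → s ℚ.+ ι d ℚ.* Of.unit f (suc n)) same
      (≤-antisym (digit≤ e f n same) (digit≤ f e n (sym same))))
    (sym (Of.S-suc f n)))
    where same = S-unique e f n

  digit-unique : ∀ (e f : Expansion Q x) n → digit e n ≡ digit f n
  digit-unique e f n = ≤-antisym (digit≤ e f n (S-unique e f n)) (digit≤ f e n (S-unique f e n))

-- Quotients near 1 and bounds for the expected counts.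

∑-nonNeg : ∀ n {f} → (∀ i → 0ℚ ℚ.≤ f i) → 0ℚ ℚ.≤ ∑ n f
∑-nonNeg zero    0≤f = ℚ.≤-refl
∑-nonNeg (suc n) 0≤f = ℚ.+-mono-≤ (∑-nonNeg n 0≤f) (0≤f n)

∑-block : ∀ f c n l → (∀ i → n ≤ i → c ℚ.* f i ℚ.≤ 1ℚ) → c ℚ.* ∑ (l + n) f ℚ.≤ c ℚ.* ∑ n f ℚ.+ ι l
∑-block f c n zero    cf≤1 = ℚ.≤-reflexive (trans (sym (ℚ.+-identityʳ _)) (cong (c ℚ.* ∑ n f ℚ.+_) (sym ι-0)))
∑-block f c n (suc l) cf≤1 = begin
  c ℚ.* (∑ (l + n) f ℚ.+ f (l + n))              ≡⟨ ℚ.*-distribˡ-+ c _ _ ⟩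
  c ℚ.* ∑ (l + n) f ℚ.+ c ℚ.* f (l + n)          ≤⟨ ℚ.+-mono-≤ (∑-block f c n l cf≤1) (cf≤1 (l + n) (m≤n+m n l)) ⟩
  c ℚ.* ∑ n f ℚ.+ ι l ℚ.+ 1ℚ                     ≡⟨ solve 2 (λ s l → s :+ l :+ con 1ℚ := s :+ (con 1ℚ :+ l)) refl (c ℚ.* ∑ n f) (ι l) ⟩
  c ℚ.* ∑ n f ℚ.+ (1ℚ ℚ.+ ι l)                   ≡⟨ cong (c ℚ.* ∑ n f ℚ.+_) (trans (ι-homo-+ 1 l) (cong (ℚ._+ ι l) ι-1)) ⟨
  c ℚ.* ∑ n f ℚ.+ ι (suc l)                      ∎
  where
  open ℚ.≤-Reasoning
  open ℚ-Solver.+-*-Solver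

ι*recip≤1 : ∀ {m d} .{{_ : NonZero d}} → m ≤ d → ι m ℚ.* recip d ℚ.≤ 1ℚ
ι*recip≤1 {m} {d} m≤d = ℚ.≤-trans
  (ℚ.*-monoʳ-≤-nonNeg (recip d) {{ℚ.pos⇒nonNeg (recip d) {{recip-pos d}}}} (ι-mono-≤ m≤d))
  (ℚ.≤-reflexive (ι-inverse d))

÷-cancel : ∀ p q .{{_ : ℚ.NonZero q}} → (p ÷ q) ℚ.* q ≡ p
÷-cancel p q = trans (ℚ.*-assoc p (ℚ.1/ q) q) (trans (cong (p ℚ.*_) (ℚ.*-inverseˡ q)) (ℚ.*-identityʳ p))

opaque

  quotient-close : ∀ {p q ε} → 0ℚ ℚ.< q → abs (p ℚ.- q) ℚ.< ε ℚ.* q →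
    Σ[ q≢0 ∈ ℚ.NonZero q ] abs ((p ÷ q) {{q≢0}} ℚ.- 1ℚ) ℚ.< ε
  quotient-close {p} {q} {ε} 0<q close = q≢0 , ℚ.*-cancelʳ-<-nonNeg q {{ℚ.nonNegative (ℚ.<⇒≤ 0<q)}} (begin-strict
    abs ((p ÷ q) ℚ.- 1ℚ) ℚ.* q       ≡⟨ cong (abs ((p ÷ q) ℚ.- 1ℚ) ℚ.*_) (ℚ.0≤p⇒∣p∣≡p (ℚ.<⇒≤ 0<q)) ⟨
    abs ((p ÷ q) ℚ.- 1ℚ) ℚ.* abs q   ≡⟨ ℚ.∣p*q∣≡∣p∣*∣q∣ ((p ÷ q) ℚ.- 1ℚ) q ⟨
    abs (((p ÷ q) ℚ.- 1ℚ) ℚ.* q)     ≡⟨ cong abs (solve 2 (λ x q → (x :+ :- con 1ℚ) :* q := x :* q :+ :- q) refl (p ÷ q) q) ⟩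
    abs ((p ÷ q) ℚ.* q ℚ.- q)        ≡⟨ cong (λ x → abs (x ℚ.- q)) (÷-cancel p q) ⟩
    abs (p ℚ.- q)                    <⟨ close ⟩
    ε ℚ.* q                          ∎)
    where
    open ℚ.≤-Reasoning
    open ℚ-Solver.+-*-Solver
    instance
      q≢0 : ℚ.NonZero q
      q≢0 = ℚ.>-nonZero 0<q

  quotient-bound : ∀ {p q} .{{_ : ℚ.NonZero q}} → 0ℚ ℚ.≤ q → abs ((p ÷ q) ℚ.- 1ℚ) ℚ.< 1ℚ → p ℚ.≤ q ℚ.+ q
  quotient-bound {p} {q} 0≤q close = begin
    p                        ≡⟨ ÷-cancel p q ⟨
    (p ÷ q) ℚ.* q            ≤⟨ ℚ.*-monoʳ-≤-nonNeg q {{ℚ.nonNegative 0≤q}} (ℚ.<⇒≤ r<2) ⟩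
    (1ℚ ℚ.+ 1ℚ) ℚ.* q        ≡⟨ solve 1 (λ q → (con 1ℚ :+ con 1ℚ) :* q := q :+ q) refl q ⟩
    q ℚ.+ q                  ∎
    where
    open ℚ.≤-Reasoning
    open ℚ-Solver.+-*-Solver
    r<2 : p ÷ q ℚ.< 1ℚ ℚ.+ 1ℚ
    r<2 = <-shift {q = 1ℚ} {p′ = p ÷ q} (ℚ.≤-<-trans (p≤abs ((p ÷ q) ℚ.- 1ℚ)) close)
      (solve 1 (λ r → r :+ con 1ℚ := con 1ℚ :+ con 1ℚ :+ (r :+ :- con 1ℚ)) refl (p ÷ q))

  ι-close : ∀ {ε} c a b → 0ℚ ℚ.< ε → 1ℚ ℚ.≤ ε ℚ.* ι c → c * ∣ a - b ∣ < b →
    abs (ι a ℚ.- ι b) ℚ.< ε ℚ.* ι b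
  ι-close {ε} c a b 0<ε 1≤εc close = begin-strict
    abs (ι a ℚ.- ι b)              ≤⟨ abs-≤ (upper a b ∣ a - b ∣ (m≤n+∣m-n∣ a b)) (upper b a ∣ a - b ∣ (m≤n+∣n-m∣ b a)) ⟩
    ι ∣ a - b ∣                    ≡⟨ ℚ.*-identityˡ _ ⟨
    1ℚ ℚ.* ι ∣ a - b ∣             ≤⟨ ℚ.*-monoʳ-≤-nonNeg (ι ∣ a - b ∣) {{ι-nonNeg ∣ a - b ∣}} 1≤εc ⟩
    ε ℚ.* ι c ℚ.* ι ∣ a - b ∣      ≡⟨ ℚ.*-assoc ε (ι c) _ ⟩
    ε ℚ.* (ι c ℚ.* ι ∣ a - b ∣)    ≡⟨ cong (ε ℚ.*_) (ι-homo-* c ∣ a - b ∣) ⟨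
    ε ℚ.* ι (c * ∣ a - b ∣)        <⟨ ℚ.*-monoʳ-<-pos ε {{ℚ.positive 0<ε}} (ι-mono-< close) ⟩
    ε ℚ.* ι b                      ∎
    where
    open ℚ.≤-Reasoning
    upper : ∀ m n d → m ≤ n + d → ι m ℚ.≤ ι n ℚ.+ ι d
    upper m n d m≤n+d = subst (ι m ℚ.≤_) (ι-homo-+ n d) (ι-mono-≤ m≤n+d)

module Expected (Q : BasicSequence) (k : ℕ) where

  weight : ℕ → ℚ
  weight i = ((ℤ.+ 1) / prod Q i (suc k)) {{prod≢0 Q i (suc k)}}

  weight≡recip : ∀ i → weight i ≡ recip (prod Q i (suc k)) {{prod≢0 Q i (suc k)}}
  weight≡recip i = recip-/ (prod Q i (suc k)) {{prod≢0 Q i (suc k)}}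

  0≤weight : ∀ i → 0ℚ ℚ.≤ weight i
  0≤weight i = subst (0ℚ ℚ.≤_) (sym (weight≡recip i))
    (ℚ.<⇒≤ (ℚ.positive⁻¹ _ {{recip-pos (prod Q i (suc k)) {{prod≢0 Q i (suc k)}}}}))

  -- Of the k + 1 factors in the denominator only the last is estimated by `m`; the others are at
  -- least 1. One bound on the terms thus serves all block lengths.
  ι*weight≤1 : ∀ {m} i → m ≤ term Q (i + k) → ι m ℚ.* weight i ℚ.≤ 1ℚ
  ι*weight≤1 {m} i m≤q = subst (λ r → ι m ℚ.* r ℚ.≤ 1ℚ) (sym (weight≡recip i))
    (ι*recip≤1 {{prod≢0 Q i (suc k)}} (≤-trans m≤q (m≤n*m (term Q (i + k)) (prod Q i k) {{prod≢0 Q i k}})))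

  opaque

    X : ℕ → ℚ
    X = expected Q (suc k)

  opaque
    unfolding X

    X≡expected : ∀ n → X n ≡ expected Q (suc k) n
    X≡expected n = refl

    0≤X : ∀ n → 0ℚ ℚ.≤ X n
    0≤X n = ∑-nonNeg n 0≤weight

    X-block : ∀ m n l → (∀ i → n ≤ i → m ≤ term Q (i + k)) → ι m ℚ.* X (l + n) ℚ.≤ ι m ℚ.* X n ℚ.+ ι l
    X-block m n l m≤q = ∑-block weight (ι m) n l λ i n≤i → ι*weight≤1 i (m≤q i n≤i)

    X-zero : X 0 ≡ 0ℚ
    X-zero = refl

  X≤ι : ∀ n → X n ℚ.≤ ι n
  X≤ι n = begin
    X n                       ≡⟨ cong X (+-identityʳ n) ⟨
    X (n + 0)                 ≡⟨ ℚ.*-identityˡ _ ⟨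
    1ℚ ℚ.* X (n + 0)          ≡⟨ cong (ℚ._* X (n + 0)) ι-1 ⟨
    ι 1 ℚ.* X (n + 0)         ≤⟨ X-block 1 0 n (λ i _ → <⇒≤ (2≤term Q (i + k))) ⟩
    ι 1 ℚ.* X 0 ℚ.+ ι n       ≡⟨ cong (λ x → ι 1 ℚ.* x ℚ.+ ι n) X-zero ⟩
    ι 1 ℚ.* 0ℚ ℚ.+ ι n        ≡⟨ cong (ℚ._+ ι n) (ℚ.*-zeroʳ (ι 1)) ⟩
    0ℚ ℚ.+ ι n                ≡⟨ ℚ.+-identityˡ (ι n) ⟩
    ι n                       ∎
    where open ℚ.≤-Reasoning

-- The constructed number is ratio normal but normal of no order.

module Counterexample (Q : BasicSequence) (Q→∞ : InfiniteInLimit Q) where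

  open Construction Q Q→∞
  open Sums Q ℤ.0ℤ E E<term
  open Limit E-not-maximal {limit} S⟶limit

  expansion : Expansion Q limit
  expansion .whole       = ℤ.0ℤ
  expansion .digit       = E
  expansion .whole≤x     = whole≤ᴿ
  expansion .x<whole+1   = <ᴿwhole+1
  expansion .digit<term  = E<term
  expansion .not-maximal = E-not-maximal
  expansion .converges   = S⟶⇒partialSum⟶ limit S⟶limit

  limit∈RN : RatioNormal Q limit
  limit∈RN = expansion , λ j B₁ B₂ ε 0<ε →
    let c , 1≤εc  = archimedean 0<ε
        N , close = occurrences-close B₁ B₂ c
    in N , λ n N≤n →
      let a = occurrences E B₁ n
          b = occurrences E B₂ n
      in subst₂ (λ p q → Σ[ q≢0 ∈ ℚ.NonZero q ] abs ((p ÷ q) {{q≢0}} ℚ.- 1ℚ) ℚ.< ε) (sym (ι-/1 a)) (sym (ι-/1 b))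
           (quotient-close {ι a} {ι b} (subst (ℚ._< ι b) ι-0 (ι-mono-< (≤-<-trans z≤n (close n N≤n))))
             (ι-close c a b 0<ε 1≤εc (close n N≤n)))

  module _ (k : ℕ) where

    open Expected Q k

    X-linear : ∃[ C ] ∀ j → ι 4 ℚ.* X (chunkStart j) ℚ.≤ ι (C + j)
    -- `demand≤term` requires a positive stage, since stage 0 is entered without a test.
    X-linear with J , 0<stage ← stage-unbounded 1 = 4 * chunkStart J , linear
      where
      open ℚ.≤-Reasoning
      open ℚ-Solver.+-*-Solver
      -- The crude bound `X≤ι` with this constant covers all chunks up to `J`.
      C = 4 * chunkStart J
      short : ∀ {j} → j ≤ J → ι 4 ℚ.* X (chunkStart j) ℚ.≤ ι (C + j)
      short {j} j≤J = begin
        ι 4 ℚ.* X (chunkStart j)        ≤⟨ ℚ.*-monoˡ-≤-nonNeg (ι 4) {{ι-nonNeg 4}} (X≤ι (chunkStart j)) ⟩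
        ι 4 ℚ.* ι (chunkStart j)        ≡⟨ ι-homo-* 4 (chunkStart j) ⟨
        ι (4 * chunkStart j)            ≤⟨ ι-mono-≤ (≤-trans (*-monoʳ-≤ 4 (chunkStart-mono j≤J)) (m≤m+n C j)) ⟩
        ι (C + j)                       ∎
      step : ∀ {j} → J ≤ j → ι 4 ℚ.* X (chunkStart (suc j)) ℚ.≤ ι 4 ℚ.* X (chunkStart j) ℚ.+ ι 1
      -- Multiplied by `s`, the claim is `X-block` for `s` terms of size at most 1/(4 s).
      step {j} J≤j = ℚ.*-cancelˡ-≤-pos (ι s) {{ι-pos}} (begin
        ι s ℚ.* (ι 4 ℚ.* X (chunkStart (suc j)))      ≡⟨ solve 3 (λ s f x → s :* (f :* x) := (f :* s) :* x) refl (ι s) (ι 4) (X (chunkStart (suc j))) ⟩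
        ι 4 ℚ.* ι s ℚ.* X (chunkStart (suc j))        ≡⟨ cong₂ (λ c n → c ℚ.* X n) (sym (ι-homo-* 4 s)) (chunkStart-suc j) ⟩
        ι (4 * s) ℚ.* X (s + chunkStart j)            ≤⟨ X-block (4 * s) (chunkStart j) s (λ i start≤i → ≤-trans (m≤n+m (4 * s) (stage j)) (demand≤term (0<stage J≤j) (≤-trans (j≤chunkStart j) (≤-trans start≤i (m≤m+n i k))))) ⟩
        ι (4 * s) ℚ.* X (chunkStart j) ℚ.+ ι s        ≡⟨ cong (λ c → c ℚ.* X (chunkStart j) ℚ.+ ι s) (ι-homo-* 4 s) ⟩
        ι 4 ℚ.* ι s ℚ.* X (chunkStart j) ℚ.+ ι s      ≡⟨ solve 3 (λ f s x → f :* s :* x :+ s := s :* (f :* x :+ con 1ℚ)) refl (ι 4) (ι s) (X (chunkStart j)) ⟩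
        ι s ℚ.* (ι 4 ℚ.* X (chunkStart j) ℚ.+ 1ℚ)     ≡⟨ cong (λ o → ι s ℚ.* (ι 4 ℚ.* X (chunkStart j) ℚ.+ o)) ι-1 ⟨
        ι s ℚ.* (ι 4 ℚ.* X (chunkStart j) ℚ.+ ι 1)    ∎)
        where
        s = size (stage j)
        ι-pos : ℚ.Positive (ι s)
        ι-pos = ℚ.positive (subst (ℚ._< ι s) ι-0 (ι-mono-< z<s))
      linear : ∀ j → ι 4 ℚ.* X (chunkStart j) ℚ.≤ ι (C + j)
      linear zero    = short z≤n
      linear (suc j) with ≤-<-connex (suc j) J
      ... | inj₁ j<J = short j<J
      ... | inj₂ J<j = begin
        ι 4 ℚ.* X (chunkStart (suc j))        ≤⟨ step (≤-pred J<j) ⟩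
        ι 4 ℚ.* X (chunkStart j) ℚ.+ ι 1      ≤⟨ ℚ.+-monoˡ-≤ (ι 1) (linear j) ⟩
        ι (C + j) ℚ.+ ι 1                     ≡⟨ ι-homo-+ (C + j) 1 ⟨
        ι (C + j + 1)                         ≡⟨ cong ι (trans (+-assoc C j 1) (cong (_+_ C) (+-comm j 1))) ⟩
        ι (C + suc j)                         ∎

    2*a≤ : ∀ {a n c} → ι a ℚ.≤ X n ℚ.+ X n → ι 4 ℚ.* X n ℚ.≤ ι c → 2 * a ≤ c
    2*a≤ {a} {n} {c} a≤X+X 4X≤ = ι-cancel-≤ (begin
      ι (2 * a)                     ≡⟨ ι-homo-* 2 a ⟩
      ι 2 ℚ.* ι a                   ≤⟨ ℚ.*-monoˡ-≤-nonNeg (ι 2) {{ι-nonNeg 2}} a≤X+X ⟩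
      ι 2 ℚ.* (X n ℚ.+ X n)         ≡⟨ solve 2 (λ t x → t :* (x :+ x) := (t :+ t) :* x) refl (ι 2) (X n) ⟩
      (ι 2 ℚ.+ ι 2) ℚ.* X n         ≡⟨ cong (ℚ._* X n) (ι-homo-+ 2 2) ⟨
      ι 4 ℚ.* X n                   ≤⟨ 4X≤ ⟩
      ι c                           ∎)
      where
      open ℚ.≤-Reasoning
      open ℚ-Solver.+-*-Solver

    -- The two inequalities together force j ≤ 2 J + C, which the choice of `j` rules out.
    too-frequent : ∀ {J C N a j} → j ≡ suc (J + J + C) + N → j ≤ J + a → 2 * a ≤ C + j → ⊥
    too-frequent {J} {C} {N} {a} {j} eq j≤J+a 2a≤C+j = <-irrefl refl (begin-strict
      j + j                                   ≤⟨ +-mono-≤ j≤J+a j≤J+a ⟩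
      (J + a) + (J + a)                       ≡⟨ solve 2 (λ J a → (J :+ a) :+ (J :+ a) := J :+ J :+ con 2 :* a) refl J a ⟩
      J + J + 2 * a                           ≤⟨ +-monoʳ-≤ (J + J) 2a≤C+j ⟩
      J + J + (C + j)                         ≡⟨ +-assoc (J + J) C j ⟨
      J + J + C + j                           <⟨ +-monoˡ-< j (m≤m+n (suc (J + J + C)) N) ⟩
      suc (J + J + C) + N + j                 ≡⟨ cong (_+ j) eq ⟨
      j + j                                   ∎)
      where
      open ≤-Reasoning
      open +-*-Solver

    limit∉N : ¬ NormalOfOrder Q (suc k) limit
    limit∉N (e , normal) =
      let B           = replicate (suc k) 0
          -- Tolerance 1 means a quotient below 2, which is all that `quotient-bound` takes.
          N , close   = normal B 1ℚ (ℚ.positive⁻¹ 1ℚ)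
          J , starts≥ = starts-linear B
          C , X≤      = X-linear
      -- The summand `N` pushes the start of chunk `j` past `N`; the rest makes `j` exceed 2 J + C.
      in beyond B N close J starts≥ C X≤ (suc (J + J + C) + N) refl
      where
      beyond : ∀ (B : Vec ℕ (suc k)) N →
        (∀ n → N ≤ n → Σ[ X≢0 ∈ ℚ.NonZero (expected Q (suc k) n) ]
          abs ((occurrencesℚ (digit e) B n ÷ expected Q (suc k) n) {{X≢0}} ℚ.- 1ℚ) ℚ.< 1ℚ) →
        ∀ J → (∀ j → j ≤ J + starts B (chunkStart j)) →
        ∀ C → (∀ j → ι 4 ℚ.* X (chunkStart j) ℚ.≤ ι (C + j)) →
        ∀ j → j ≡ suc (J + J + C) + N → ⊥
      beyond B N close J starts≥ C X≤ j eq = too-frequent {J} {C} {N} {a} eq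
        (≤-trans (starts≥ j) (+-monoʳ-≤ J (starts≤occurrences (Uniqueness.digit-unique e expansion) B n)))
        (2*a≤ {a} {n} {C + j} a≤X+X (X≤ j))
        where
        n = chunkStart j
        a = occurrences (digit e) B n
        a≤X+X : ι a ℚ.≤ X n ℚ.+ X n
        near = close n (≤-trans (subst (N ≤_) (sym eq) (m≤n+m N _)) (j≤chunkStart j))
        a≤X+X = subst₂ ℚ._≤_ (ι-/1 a) (sym (cong₂ ℚ._+_ (X≡expected n) (X≡expected n)))
          (quotient-bound {occurrencesℚ (digit e) B n} {expected Q (suc k) n} {{proj₁ near}}
            (subst (0ℚ ℚ.≤_) (X≡expected n) (0≤X n)) (proj₂ near))

theorem3p13 : (Q : BasicSequence) → InfiniteInLimit Q →
    Satisfiable (RatioNormal Q ∖ (⋃[ j ∶ ℕ ] NormalOfOrder Q (suc j)))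
    × Satisfiable (RatioNormal Q ∖ Normal Q)
theorem3p13 Q Q→∞ =
  (limit , limit∈RN , λ (j , normal) → limit∉N j normal) ,
  (limit , limit∈RN , λ normal → limit∉N 0 (normal 0))
  where
  open Counterexample Q Q→∞
  open Sums Q ℤ.0ℤ (Construction.E Q Q→∞) (Construction.E<term Q Q→∞)
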